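{- Let $A$ be a bounded distributive lattice, $X$ its Priestley space, and $\kappa$ a regular cardinal. (1) $A$ is a complete lattice that is a $\kappa$-frame if and only if $X$ is extremally order disconnected and ${\sf cl}(U)$ is a clopen upset for each $\kappa$-clopen upset $U$. (2) $A$ is a $\kappa$-complete Heyting lattice if and only if $X$ is an Esakia space and ${\sf cl}(U)$ is a clopen upset for each $\kappa$-clopen upset $U$. (3) Every relative annihilator of $A$ belongs to $\mathcal{BL}_\kappa A$ if and only if $X\setminus{\downarrow}U\in{\sf BL}_\kappa(X)$ for each clopen $U\subseteq X$. (4) Every relative annihilator of $A$ is a normal ideal belonging to $\mathcal{BL}_\kappa A$ if and only if $X\setminus{\downarrow}U\in{\sf DM}(X)\cap{\sf BL}_\kappa(X)$ for each clopen $U\subseteq X$.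
   Context: A $\kappa$-frame is a lattice in which all joins of fewer than $\kappa$ elements exist and are distributive ($a\wedge\bigvee S=\bigvee\{a\wedge s\}$); $\kappa$-complete means such joins exist; a Heyting lattice has $\to$ with $a\wedge b\le c\iff a\le b\to c$. A relative annihilator is $\langle a,b\rangle=\{x:a\wedge x\le b\}$; a normal ideal is a downset $N=N^{u\ell}$. $\mathcal{BL} A$ is the frame of D-ideals (downsets containing $\bigvee S$ for each subset $S$ with distributive join), with $A$ identified with its principal downsets, and $\mathcal{BL}_\kappa A$ is the sub-$\kappa$-frame of $\mathcal{BL} A$ generated by $A$. The Priestley space $X$ of $A$ is the set of prime filters ordered by inclusion, with topology generated by $\{\mathfrak s(a)\setminus\mathfrak s(b)\}$, $\mathfrak s(a)=\{x:a\in x\}$. ${\sf cl}$ is topological closure, ${\sf cl_2}(S)={\uparrow}{\sf cl}(S)$, ${\sf int_1}(S)=X\setminus{\downarrow}(X\setminus{\sf int}(S))$. A DM-set is an open upset $U$ with ${\sf int_1\,cl_2}(U)=U$; ${\sf DM}(X)$ is the set of DM-sets. A $\kappa$-clopen upset is a union of fewer than $\kappa$ clopen upsets; ${\sf BL}_\kappa(X)=\{{\sf int_1\,cl}(V): V\text{ a }\kappa\text{ -clopen upset}\}$. $X$ is extremally order disconnected if ${\sf cl_2}(U)$ is clopen for every open upset $U$; $X$ is an Esakia space if ${\downarrow}U$ is clopen for every clopen $U\subseteq X$. -}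

module Defs where

open import Level using (Level; suc; _⊔_)
open import Data.List using (List)
open import Data.List.Relation.Unary.All using (All)
open import Data.Nat using (ℕ)
open import Data.Product using (Σ; ∃; ∃-syntax; _×_; _,_; proj₁; proj₂)
open import Data.Sum using (_⊎_)
open import Function using (flip; _↣_)
open import Relation.Binary using (Rel)
open import Relation.Binary.Lattice using (BoundedLattice; IsHeytingAlgebra)
open import Relation.Nullary using (¬_)
open import Relation.Unary using (Pred; _∈_; _∉_; _⊆_; _≐_; _∩_; ∁; ⋃)
import Algebra.Definitions as AlgebraDefs
import Relation.Binary.Lattice.Properties.MeetSemilattice as MeetProperties

-- A cardinal is represented by a type K of that cardinality;
-- I ≺ K says |I| < |K|.

_≺_ : ∀ {ℓ} → Set ℓ → Set ℓ → Set ℓ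
I ≺ K = (I ↣ K) × ¬ (K ↣ I)

-- An infinite cardinal that is not a sum of fewer than κ cardinals,
-- each smaller than κ.
record IsRegularCardinal {ℓ} (K : Set ℓ) : Set (suc ℓ) where
  field
    infinite : ℕ ↣ K
    regular  : ∀ {I : Set ℓ} (F : I → Set ℓ) →
               I ≺ K → (∀ i → F i ≺ K) → Σ I F ≺ K

module _ {c i r} {C : Set c} {I : Set i} (_≤_ : Rel C r) where

  IsLub : (I → C) → C → Set (c ⊔ i ⊔ r)
  IsLub f s = (∀ i → f i ≤ s) × (∀ z → (∀ i → f i ≤ z) → s ≤ z)

IsGlb : ∀ {c i r} {C : Set c} {I : Set i} → Rel C r → (I → C) → C → Set (c ⊔ i ⊔ r)
IsGlb _≤_ = IsLub (flip _≤_)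

-- All levels of the lattice agree, so that downsets, annihilators, sets of
-- bounds etc. all live in Pred Carrier ℓ; other lattices can be lifted.
record BoundedDistributiveLattice ℓ : Set (suc ℓ) where
  field
    boundedLattice : BoundedLattice ℓ ℓ ℓ
  open BoundedLattice boundedLattice public
  open AlgebraDefs _≈_ using (_DistributesOverˡ_)
  field
    ∧-distribˡ-∨ : _∧_ DistributesOverˡ _∨_

module LatticeNotions {ℓ} (A : BoundedDistributiveLattice ℓ) where
  open BoundedDistributiveLattice A
  open MeetProperties (BoundedLattice.meetSemilattice boundedLattice)
    using (∧-monotonic)

  -- A subset S is viewed as the family proj₁ : ∃ S → Carrier.
  IsJoin IsMeet : Pred Carrier ℓ → Carrier → Set ℓ
  IsJoin S = IsLub {I = ∃ S} _≤_ proj₁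
  IsMeet S = IsGlb {I = ∃ S} _≤_ proj₁

  IsDistributiveLub : {I : Set ℓ} → (I → Carrier) → Carrier → Set ℓ
  IsDistributiveLub f s =
    IsLub _≤_ f s × (∀ a → IsLub _≤_ (λ i → a ∧ f i) (a ∧ s))

  IsDistributiveJoin : Pred Carrier ℓ → Carrier → Set ℓ
  IsDistributiveJoin S = IsDistributiveLub {I = ∃ S} proj₁

  IsCompleteLattice : Set (suc ℓ)
  IsCompleteLattice = (S : Pred Carrier ℓ) → ∃ (IsJoin S) × ∃ (IsMeet S)

  -- Joins of fewer than κ elements are joins of families indexed by
  -- a type of cardinality less than κ.
  IsκComplete : Set ℓ → Set (suc ℓ)
  IsκComplete K = (I : Set ℓ) → I ≺ K → (f : I → Carrier) → ∃[ s ] IsLub _≤_ f s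

  IsκFrame : Set ℓ → Set (suc ℓ)
  IsκFrame K = (I : Set ℓ) → I ≺ K → (f : I → Carrier) → ∃[ s ] IsDistributiveLub f s

  IsHeytingLattice : Set ℓ
  IsHeytingLattice = ∃ λ _⇨_ → IsHeytingAlgebra _≈_ _≤_ _∨_ _∧_ _⇨_ ⊤ ⊥

  IsDownset : Pred Carrier ℓ → Set ℓ
  IsDownset N = ∀ {x y} → x ≤ y → y ∈ N → x ∈ N

  upperBounds lowerBounds : Pred Carrier ℓ → Pred Carrier ℓ
  upperBounds N x = ∀ {y} → y ∈ N → y ≤ x
  lowerBounds N x = ∀ {y} → y ∈ N → x ≤ y

  IsNormalIdeal : Pred Carrier ℓ → Set ℓ
  IsNormalIdeal N = IsDownset N × N ≐ lowerBounds (upperBounds N)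

  record DIdeal : Set (suc ℓ) where
    field
      member : Pred Carrier ℓ
      down   : IsDownset member
      joins  : ∀ (S : Pred Carrier ℓ) s →
               S ⊆ member → IsDistributiveJoin S s → s ∈ member
  open DIdeal public

  _⊑_ : Rel DIdeal ℓ
  D ⊑ E = member D ⊆ member E

  principal : Carrier → DIdeal
  principal a = record
    { member = _≤ a
    ; down   = trans
    ; joins  = λ S s S⊆ (lub , _) → proj₂ lub a (λ (x , x∈S) → S⊆ x∈S)
    }

  annihilator : Carrier → Carrier → DIdeal
  annihilator a b = record
    { member = λ x → (a ∧ x) ≤ b
    ; down   = λ x≤y a∧y≤b → trans (∧-monotonic refl x≤y) a∧y≤b
    ; joins  = λ S s S⊆ (_ , dist) → proj₂ (dist a) b (λ (x , x∈S) → S⊆ x∈S)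
    }

  -- The sub-κ-frame of the frame of D-ideals generated by the principal
  -- downsets (A itself). Meets of D-ideals are intersections, joins are taken in
  -- poset of D-ideals; the bounds are principal D ⊤ and D ⊥.
  data 𝓑𝓛 (K : Set ℓ) : Pred DIdeal (suc ℓ) where
    generator : ∀ {D} a → member D ≐ member (principal a) → 𝓑𝓛 K D
    meet      : ∀ {D E M} → 𝓑𝓛 K D → 𝓑𝓛 K E →
                member M ≐ member D ∩ member E → 𝓑𝓛 K M
    join      : ∀ {J} (I : Set ℓ) → I ≺ K → (D : I → DIdeal) →
                (∀ i → 𝓑𝓛 K (D i)) → IsLub _⊑_ D J → 𝓑𝓛 K J

module PriestleySpace {ℓ} (A : BoundedDistributiveLattice ℓ) where
  open BoundedDistributiveLattice A

  record X : Set (suc ℓ) where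
    field
      filter   : Pred Carrier ℓ
      up       : ∀ {a b} → a ≤ b → a ∈ filter → b ∈ filter
      ⊤-closed : ⊤ ∈ filter
      ∧-closed : ∀ {a b} → a ∈ filter → b ∈ filter → a ∧ b ∈ filter
      proper   : ⊥ ∉ filter
      prime    : ∀ {a b} → a ∨ b ∈ filter → a ∈ filter ⊎ b ∈ filter
  open X public

  _≼_ : Rel X ℓ
  x ≼ y = filter x ⊆ filter y

  𝔰 : Carrier → Pred X ℓ
  𝔰 a x = a ∈ filter x

  -- Finite intersections of the subbasic sets 𝔰 a ∖ 𝔰 b; the open sets are
  -- the unions of these.
  basic : List (Carrier × Carrier) → Pred X ℓ
  basic ps x = All (λ (a , b) → x ∈ 𝔰 a ∩ ∁ (𝔰 b)) ps

  private variable
    u : Level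

  int cl : Pred X u → Pred X (suc ℓ ⊔ u)
  int S x = ∃[ ps ] x ∈ basic ps × basic ps ⊆ S
  cl  S x = ∀ ps → x ∈ basic ps → ∃[ y ] y ∈ basic ps × y ∈ S

  IsOpen IsClosed IsClopen IsUpset IsClopenUpset : Pred X u → Set (suc ℓ ⊔ u)
  IsOpen U        = U ⊆ int U
  IsClosed U      = IsOpen (∁ U)
  IsClopen U      = IsOpen U × IsClosed U
  IsUpset U       = ∀ {x y} → x ≼ y → x ∈ U → y ∈ U
  IsClopenUpset U = IsClopen U × IsUpset U

  ↑ ↓ : Pred X u → Pred X (suc ℓ ⊔ u)
  ↑ S x = ∃[ y ] y ∈ S × y ≼ x
  ↓ S x = ∃[ y ] y ∈ S × x ≼ y

  cl₂ int₁ : Pred X u → Pred X (suc ℓ ⊔ u)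
  cl₂  S = ↑ (cl S)
  int₁ S = ∁ (↓ (∁ (int S)))

  -- Pred X (suc ℓ) is closed under all the operations above.
  𝓟X : Set (suc (suc ℓ))
  𝓟X = Pred X (suc ℓ)

  DM : 𝓟X → Set (suc ℓ)
  DM U = IsOpen U × IsUpset U × int₁ (cl₂ U) ≐ U

  IsκClopenUpset : Set ℓ → 𝓟X → Set (suc (suc ℓ))
  IsκClopenUpset K U =
    ∃[ I ] (I ≺ K) × Σ (I → 𝓟X) λ V → (∀ i → IsClopenUpset (V i)) × U ≐ ⋃ I V

  BL : Set ℓ → 𝓟X → Set (suc (suc ℓ))
  BL K W = ∃[ V ] IsκClopenUpset K V × W ≐ int₁ (cl V)

  IsExtremallyOrderDisconnected : Set (suc (suc ℓ))
  IsExtremallyOrderDisconnected = (U : 𝓟X) → IsOpen U → IsUpset U → IsClopen (cl₂ U)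

  IsEsakiaSpace : Set (suc (suc ℓ))
  IsEsakiaSpace = (U : 𝓟X) → IsClopen U → IsClopen (↓ U)

{-# OPTIONS --safe #-}
module Submission where

-- Excluded middle for all types includes global choice, whence Zorn's lemma, the prime
-- filter theorem and compactness of X.  With V = ⋃ᵢ 𝔰 (f i), the
-- dictionary is: s is the join of f iff cl₂ V = 𝔰 s, and the distributive join iff
-- cl V = 𝔰 s; the D-ideal generated by f consists of the c with 𝔰 c ⊆ cl V, that is
-- 𝔰 c ⊆ int₁ (cl V); and c ∈ ⟨ a , b ⟩ iff 𝔰 c ⊆ X ∖ ↓ (𝔰 a ∖ 𝔰 b).  By regularity of κ and
-- distributivity, the members of 𝓑𝓛 are exactly the D-ideals generated by fewer than κ
-- elements.  A clopen set is a finite union of sets 𝔰 a ∖ 𝔰 b, and the families BL and DM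
-- are closed under binary intersections, so it suffices to treat 𝔰 a ∖ 𝔰 b.

open import Defs
open import Axiom.ExcludedMiddle using (ExcludedMiddle)
open import Axiom.Extensionality.Propositional using (Extensionality)
open import Data.Bool using (Bool; true; false; T)
open import Data.Empty using (⊥-elim)
open import Data.List using ([]; _∷_)
open import Data.List.Relation.Unary.All using ([]; _∷_)
open import Data.Product using (Σ; ∃; ∃-syntax; _×_; _,_; proj₁; proj₂)
open import Data.Product.Function.NonDependent.Propositional using (_×-⇔_)
open import Data.Sum using (_⊎_; inj₁; inj₂; [_,_]′)
import Data.Unit.Polymorphic as UnitP
open import Function using (_⇔_; mk⇔; Equivalence; _∘_; id; mk↣; Injection)
open import Level using (Level; Lift; lift; lower; suc; _⊔_)
open import Relation.Binary.Lattice using (DistributiveLattice; IsHeytingAlgebra)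
open import Relation.Binary.PropositionalEquality using (_≡_; refl; subst)
open import Relation.Nullary using (¬_; Dec; yes; no; contradiction)
open import Relation.Nullary.Decidable using (isYes; toWitness; fromWitness; decidable-stable)
open import Relation.Unary using (Pred; _∈_; _∉_; _⊆_; _≐_; _∩_; _∪_; ∁; ⋃)
open import Relation.Unary.Relation.Binary.Subset using (⊆-isPartialOrder)

private variable
  a p q g : Level

module Classical (em : ∀ {a} → ExcludedMiddle a) (ext : ∀ {a b} → Extensionality a b) where

  -- Brings a proposition of any universe level down to `Bool`. Subsets given as `C → Bool` are
  -- therefore closed under unions of arbitrary families without a rise in level.
  ⌊_⌋ : Set a → Bool
  ⌊ P ⌋ = isYes (em {P = P})

  dne : {P : Set p} → ¬ ¬ P → P
  dne = decidable-stable em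

  ⊈⇒∃ : {C : Set a} {P : Pred C p} {Q : Pred C q} → ¬ (P ⊆ Q) → ∃[ x ] x ∈ P × x ∉ Q
  ⊈⇒∃ P⊈Q = dne λ ¬∃ → P⊈Q λ {x} x∈P → dne λ x∉Q → ¬∃ (x , x∈P , x∉Q)

  -- Zorn's lemma for families of subsets under inclusion.

  module Zorn {c} {C : Set c} (Good : Pred (C → Bool) g) where

    infix 4 _⊑_
    _⊑_ : (C → Bool) → (C → Bool) → Set c
    P ⊑ Q = T ∘ P ⊆ T ∘ Q

    ⊑-antisym : ∀ {P Q} → P ⊑ Q → Q ⊑ P → P ≡ Q
    ⊑-antisym P⊑Q Q⊑P = ext λ x → T-injective P⊑Q Q⊑P
      where
      T-injective : ∀ {a b} → (T a → T b) → (T b → T a) → a ≡ b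
      T-injective {false} {false} f g = refl
      T-injective {false} {true}  f g = ⊥-elim (g _)
      T-injective {true}  {false} f g = ⊥-elim (f _)
      T-injective {true}  {true}  f g = refl

    ⨆ : ((C → Bool) → Bool) → C → Bool
    ⨆ 𝓠 x = ⌊ ∃[ P ] T (𝓠 P) × T (P x) ⌋

    -- The witness inside `yes` is the chosen enlargement: excluded middle acts as a choice
    -- function. A `P` without a proper good enlargement stays fixed.
    extend-dec : ∀ P → Dec (∃[ P′ ] Good P′ × P ⊑ P′ × ¬ P′ ⊑ P) → C → Bool
    extend-dec P (yes (P′ , _)) = P′
    extend-dec P (no _)         = P

    extend : (C → Bool) → C → Bool
    extend P = extend-dec P em

    ⊑-extend : ∀ P → P ⊑ extend P
    ⊑-extend P with em {P = ∃[ P′ ] Good P′ × P ⊑ P′ × ¬ P′ ⊑ P}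
    ... | yes (_ , _ , P⊑P′ , _) = P⊑P′
    ... | no _                   = id

    extend-good : ∀ {P} → Good P → Good (extend P)
    extend-good {P} gP with em {P = ∃[ P′ ] Good P′ × P ⊑ P′ × ¬ P′ ⊑ P}
    ... | yes (_ , gP′ , _) = gP′
    ... | no _              = gP

    extend-fixed⇒maximal : ∀ {P} → extend P ⊑ P → ∀ P′ → Good P′ → P ⊑ P′ → P′ ⊑ P
    extend-fixed⇒maximal {P} fixed P′ gP′ P⊑P′ with em {P = ∃[ P′ ] Good P′ × P ⊑ P′ × ¬ P′ ⊑ P}
    ... | yes (_ , _ , _ , P″⋢P) = ⊥-elim (P″⋢P fixed)
    ... | no maximal = dne λ P′⋢P → maximal (P′ , gP′ , P⊑P′ , P′⋢P)

    module _ (base : C → Bool) where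

      -- The transfinite iterates of extend.
      data Tower : Pred (C → Bool) c where
        start : Tower base
        step  : ∀ {P} → Tower P → Tower (extend P)
        union : ∀ 𝓠 → (∀ P → T (𝓠 P) → Tower P) → ∃ (T ∘ 𝓠) → Tower (⨆ 𝓠)

      base-⊑ : ∀ {P} → Tower P → base ⊑ P
      base-⊑ start                   x∈ = x∈
      base-⊑ (step t)                x∈ = ⊑-extend _ (base-⊑ t x∈)
      base-⊑ (union 𝓠 ts (P , P∈𝓠)) x∈ = fromWitness (P , P∈𝓠 , base-⊑ (ts P P∈𝓠) x∈)

      -- Either some member of the family contains `S`, and then so does the union, or all members
      -- fall under the first alternative. This is the limit case of both inductions below.
      union-comparable : ∀ 𝓠 {R S} → R ⊑ S →
        (∀ P → T (𝓠 P) → P ⊑ R ⊎ S ⊑ P) → ⨆ 𝓠 ⊑ R ⊎ S ⊑ ⨆ 𝓠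
      union-comparable 𝓠 {R} {S} R⊑S cmp with em {P = ∃[ P ] T (𝓠 P) × S ⊑ P}
      ... | yes (P , P∈𝓠 , S⊑P) = inj₂ λ x∈S → fromWitness (P , P∈𝓠 , S⊑P x∈S)
      ... | no ¬∃ = inj₁ λ x∈⨆ → let (P , P∈𝓠 , x∈P) = toWitness x∈⨆ in
          [ (λ P⊑R → P⊑R x∈P) , (λ S⊑P → contradiction (P , P∈𝓠 , λ {x} → S⊑P {x}) ¬∃) ]′ (cmp P P∈𝓠)

      -- Inner induction of the linearity proof, on `Q`, for a fixed `P` comparable with the whole
      -- tower. In the critical case `Q ⊑ P` and `P ⊑ Q`, antisymmetry identifies the two sets and
      -- hence their extensions.
      step-comparable : ∀ {P} → (∀ {Q} → Tower Q → P ⊑ Q ⊎ extend Q ⊑ P) → Tower P →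
                        ∀ {Q} → Tower Q → Q ⊑ P ⊎ extend P ⊑ Q
      step-comparable cmp tP start = inj₁ (base-⊑ tP)
      step-comparable cmp tP (step {Q} tQ) with step-comparable cmp tP tQ
      ... | inj₂ eP⊑Q = inj₂ (⊑-extend Q ∘ eP⊑Q)
      ... | inj₁ Q⊑P with cmp tQ
      ...   | inj₂ eQ⊑P = inj₁ eQ⊑P
      ...   | inj₁ P⊑Q = inj₂ (λ {x} → subst (λ R → T (extend R x)) (⊑-antisym P⊑Q Q⊑P))
      step-comparable cmp tP (union 𝓠 ts _) =
        union-comparable 𝓠 (⊑-extend _) λ Q Q∈𝓠 → step-comparable cmp tP (ts Q Q∈𝓠)

      -- Outer induction, on `P`. In the step case the induction hypothesis is what
      -- `step-comparable` asks of `P`, and this excludes a `Q` strictly between `P` and `extend P`.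
      comparable : ∀ {P} → Tower P → ∀ {Q} → Tower Q → P ⊑ Q ⊎ extend Q ⊑ P
      comparable start tQ = inj₁ (base-⊑ tQ)
      comparable (step {P} tP) {Q} tQ with comparable tP tQ
      ... | inj₂ eQ⊑P = inj₂ (⊑-extend P ∘ eQ⊑P)
      ... | inj₁ P⊑Q with step-comparable (comparable tP) tP tQ
      ...   | inj₂ eP⊑Q = inj₁ eP⊑Q
      ...   | inj₁ Q⊑P = inj₂ (λ {x} → subst (λ R → T (extend R x)) (⊑-antisym Q⊑P P⊑Q))
      comparable (union 𝓠 ts _) tQ =
        union-comparable 𝓠 (⊑-extend _) λ P P∈𝓠 → comparable (ts P P∈𝓠) tQ

      module _
        (base-good : Good base)
        (union-good : ∀ 𝓠 → (∀ P → T (𝓠 P) → Good P) →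
                      (∀ P Q → T (𝓠 P) → T (𝓠 Q) → P ⊑ Q ⊎ Q ⊑ P) →
                      ∃ (T ∘ 𝓠) → Good (⨆ 𝓠))
        where

        tower-good : ∀ {P} → Tower P → Good P
        tower-good start           = base-good
        tower-good (step t)        = extend-good (tower-good t)
        tower-good (union 𝓠 ts ne) = union-good 𝓠 (λ P P∈𝓠 → tower-good (ts P P∈𝓠)) chain ne
          where
          chain : ∀ P Q → T (𝓠 P) → T (𝓠 Q) → P ⊑ Q ⊎ Q ⊑ P
          chain P Q P∈𝓠 Q∈𝓠 with comparable (ts P P∈𝓠) (ts Q Q∈𝓠)
          ... | inj₁ P⊑Q  = inj₁ P⊑Q
          ... | inj₂ eQ⊑P = inj₂ (eQ⊑P ∘ ⊑-extend Q)

        -- The union of the whole tower is itself a stage, so its extension is a stage too and is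
        -- contained in it; a fixed point of `extend` is maximal.
        zorn : ∃[ M ] Good M × base ⊑ M × (∀ M′ → Good M′ → M ⊑ M′ → M′ ⊑ M)
        zorn = top , tower-good top-tower , base-⊑ top-tower
             , extend-fixed⇒maximal λ x∈ → fromWitness (_ , fromWitness (step top-tower) , x∈)
          where
          inTower : (C → Bool) → Bool
          inTower P = ⌊ Tower P ⌋
          top : C → Bool
          top = ⨆ inTower
          top-tower : Tower top
          top-tower = union inTower (λ _ → toWitness) (base , fromWitness start)

  -- The prime filter theorem for distributive lattices.

  module PrimeFilter {c ℓ₁ ℓ₂} (L : DistributiveLattice c ℓ₁ ℓ₂) where
    open DistributiveLattice L renaming (refl to ≤-refl)
    open import Relation.Binary.Lattice.Properties.MeetSemilattice meetSemilattice using (∧-monotonic)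

    record IsFilter (F : Pred Carrier p) : Set (c ⊔ ℓ₂ ⊔ p) where
      field
        up       : ∀ {x y} → x ≤ y → x ∈ F → y ∈ F
        ∧-closed : ∀ {x y} → x ∈ F → y ∈ F → x ∧ y ∈ F

    record IsIdeal (I : Pred Carrier p) : Set (c ⊔ ℓ₂ ⊔ p) where
      field
        down     : ∀ {x y} → x ≤ y → y ∈ I → x ∈ I
        ∨-closed : ∀ {x y} → x ∈ I → y ∈ I → x ∨ y ∈ I

    IsPrime : Pred Carrier p → Set (c ⊔ p)
    IsPrime F = ∀ {x y} → x ∨ y ∈ F → x ∈ F ⊎ y ∈ F

    module _ {F : Pred Carrier p} {I : Pred Carrier q} (isFilter : IsFilter F) (inhabited : ∃ F)
             (isIdeal : IsIdeal I) (disjoint : ∀ {x} → x ∈ F → x ∉ I) where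
      open IsIdeal isIdeal

      private
        Good : Pred (Carrier → Bool) _
        Good P = IsFilter (T ∘ P) × (∀ {x} → x ∈ T ∘ P → x ∉ I)

        open Zorn Good

        F♭ : Carrier → Bool
        F♭ x = ⌊ x ∈ F ⌋

        F♭-good : Good F♭
        F♭-good = record
          { up       = λ x≤y x∈ → fromWitness (IsFilter.up isFilter x≤y (toWitness x∈))
          ; ∧-closed = λ x∈ y∈ → fromWitness (IsFilter.∧-closed isFilter (toWitness x∈) (toWitness y∈))
          } , λ x∈ → disjoint (toWitness x∈)

        ⨆-good : ∀ 𝓠 → (∀ P → T (𝓠 P) → Good P) →
                 (∀ P Q → T (𝓠 P) → T (𝓠 Q) → P ⊑ Q ⊎ Q ⊑ P) → ∃ (T ∘ 𝓠) → Good (⨆ 𝓠)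
        ⨆-good 𝓠 good chain _ = record
          { up       = λ x≤y x∈ → let (P , P∈𝓠 , x∈P) = toWitness x∈ in
                         fromWitness (P , P∈𝓠 , IsFilter.up (proj₁ (good P P∈𝓠)) x≤y x∈P)
          ; ∧-closed = ∧-closed
          } , λ x∈ → let (P , P∈𝓠 , x∈P) = toWitness x∈ in proj₂ (good P P∈𝓠) x∈P
          where
          ∧-closed : ∀ {x y} → T (⨆ 𝓠 x) → T (⨆ 𝓠 y) → T (⨆ 𝓠 (x ∧ y))
          ∧-closed x∈ y∈ with toWitness x∈ | toWitness y∈
          ... | P , P∈𝓠 , x∈P | Q , Q∈𝓠 , y∈Q with chain P Q P∈𝓠 Q∈𝓠
          ...   | inj₁ P⊑Q = fromWitness (Q , Q∈𝓠 , IsFilter.∧-closed (proj₁ (good Q Q∈𝓠)) (P⊑Q x∈P) y∈Q)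
          ...   | inj₂ Q⊑P = fromWitness (P , P∈𝓠 , IsFilter.∧-closed (proj₁ (good P P∈𝓠)) x∈P (Q⊑P y∈Q))

        maximal-filter : ∃[ M ] Good M × F♭ ⊑ M × (∀ M′ → Good M′ → M ⊑ M′ → M′ ⊑ M)
        maximal-filter = zorn F♭ F♭-good ⨆-good

        M : Carrier → Bool
        M = proj₁ maximal-filter

        M-filter : IsFilter (T ∘ M)
        M-filter = proj₁ (proj₁ (proj₂ maximal-filter))
        open IsFilter M-filter

        F⊆M : F ⊆ T ∘ M
        F⊆M x∈F = proj₁ (proj₂ (proj₂ maximal-filter)) (fromWitness x∈F)

        -- Otherwise the filter generated by M and x would be larger.
        meets-I : ∀ {x} → ¬ T (M x) → ∃[ m ] T (M m) × m ∧ x ∈ I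
        meets-I {x} x∉M = dne λ ¬∃ → x∉M (proj₂ (proj₂ (proj₂ maximal-filter))
          (λ y → ⌊ (∃[ m ] T (M m) × m ∧ x ≤ y) ⌋)
          ( record
            { up = λ y≤z y∈ → let (m , m∈M , m∧x≤y) = toWitness y∈ in
                fromWitness (m , m∈M , trans m∧x≤y y≤z)
            ; ∧-closed = λ y∈ z∈ → let (m , m∈M , m∧x≤y) = toWitness y∈ ; (n , n∈M , n∧x≤z) = toWitness z∈ in
                fromWitness (m ∧ n , ∧-closed m∈M n∈M ,
                  ∧-greatest (trans (∧-monotonic (x∧y≤x m n) ≤-refl) m∧x≤y)
                             (trans (∧-monotonic (x∧y≤y m n) ≤-refl) n∧x≤z))
            }
          , λ y∈ y∈I → let (m , m∈M , m∧x≤y) = toWitness y∈ in ¬∃ (m , m∈M , down m∧x≤y y∈I))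
          (λ {m} m∈M → fromWitness (m , m∈M , x∧y≤x m x))
          (let (m , m∈F) = inhabited in fromWitness (m , F⊆M m∈F , x∧y≤y m x)))

        -- If `x` and `y` were both outside `M`, there would be `m` and `n` in `M` with `m ∧ x` and
        -- `n ∧ y` in `I`. By distributivity `(m ∧ n) ∧ (x ∨ y)` would then lie in both `M` and `I`.
        M-prime : IsPrime (T ∘ M)
        M-prime {x} {y} x∨y∈M with em {P = T (M x)} | em {P = T (M y)}
        ... | yes x∈M | _       = inj₁ x∈M
        ... | no _    | yes y∈M = inj₂ y∈M
        ... | no x∉M  | no y∉M  =
          let (m , m∈M , m∧x∈I) = meets-I x∉M ; (n , n∈M , n∧y∈I) = meets-I y∉M in
          contradiction
            (down (trans (reflexive (∧-distribˡ-∨ (m ∧ n) x y))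
                    (∨-least (trans (∧-monotonic (x∧y≤x m n) ≤-refl) (x≤x∨y _ _))
                             (trans (∧-monotonic (x∧y≤y m n) ≤-refl) (y≤x∨y _ _))))
                  (∨-closed m∧x∈I n∧y∈I))
            (proj₂ (proj₁ (proj₂ maximal-filter)) (∧-closed (∧-closed m∈M n∈M) x∨y∈M))

      -- Since `M` is Boolean-valued, the levels of `F` and `I` are arbitrary while the prime filter
      -- lands in any prescribed level, as the points of `X` require.
      prime-filter-theorem : ∀ ℓ → Σ (Pred Carrier ℓ) λ P →
        IsFilter P × IsPrime P × F ⊆ P × (∀ {x} → x ∈ P → x ∉ I)
      prime-filter-theorem ℓ = Lift ℓ ∘ T ∘ M
        , record { up = λ x≤y (lift x∈) → lift (up x≤y x∈)
                 ; ∧-closed = λ (lift x∈) (lift y∈) → lift (∧-closed x∈ y∈) }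
        , (λ (lift x∨y∈) → [ inj₁ ∘ lift , inj₂ ∘ lift ]′ (M-prime x∨y∈))
        , (λ x∈F → lift (F⊆M x∈F))
        , λ (lift x∈) → proj₂ (proj₁ (proj₂ maximal-filter)) x∈

  -- Serves `compactness`, where the prime filters of this lattice take the role of ultrafilters.
  powerset : Set a → ∀ p → DistributiveLattice (a ⊔ suc p) (a ⊔ p) (a ⊔ p)
  powerset C p = record
    { Carrier = Pred C p
    ; _≈_     = _≐_
    ; _≤_     = _⊆_
    ; _∨_     = _∪_
    ; _∧_     = _∩_
    ; isDistributiveLattice = record
      { isLattice = record
        { isPartialOrder = ⊆-isPartialOrder
        ; supremum       = λ _ _ → inj₁ , inj₂ , λ _ P⊆R Q⊆R → [ P⊆R , Q⊆R ]′
        ; infimum        = λ _ _ → proj₁ , proj₂ , λ _ R⊆P R⊆Q x∈R → R⊆P x∈R , R⊆Q x∈R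
        }
      ; ∧-distribˡ-∨ = λ _ _ _ →
          (λ { (x∈P , inj₁ x∈Q) → inj₁ (x∈P , x∈Q) ; (x∈P , inj₂ x∈R) → inj₂ (x∈P , x∈R) })
        , (λ { (inj₁ (x∈P , x∈Q)) → x∈P , inj₁ x∈Q ; (inj₂ (x∈P , x∈R)) → x∈P , inj₂ x∈R })
      }
    }

  -- Representation of the lattice by its prime filters.

  module Duality {ℓ} (A : BoundedDistributiveLattice ℓ) where
    open BoundedDistributiveLattice A renaming (refl to ≤-refl; trans to ≤-trans)
    open import Relation.Binary.Lattice.Properties.MeetSemilattice meetSemilattice
      using (∧-monotonic; ∧-comm; ∧-assoc)
    open LatticeNotions A
    open PriestleySpace A

    distributiveLattice : DistributiveLattice ℓ ℓ ℓ
    distributiveLattice = record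
      { isDistributiveLattice = record { isLattice = isLattice ; ∧-distribˡ-∨ = ∧-distribˡ-∨ } }

    ∈-∧ : ∀ {x a b} → x ∈ 𝔰 (a ∧ b) → x ∈ 𝔰 a × x ∈ 𝔰 b
    ∈-∧ {x} a∧b∈x = up x (x∧y≤x _ _) a∧b∈x , up x (x∧y≤y _ _) a∧b∈x

    -- X has η-equality, so a point cannot be inferred from a membership in its filter
    -- and is passed explicitly below.
    rect : Carrier → Carrier → Pred X ℓ
    rect a b = 𝔰 a ∩ ∁ (𝔰 b)

    -- The prime filter theorem applies to the principal filter of `a` and the principal ideal of
    -- `b`, which are disjoint.
    separate : ∀ {a b} → ¬ a ≤ b → ∃ (rect a b)
    separate {a} {b} a≰b =
      let (P , isFilter , isPrime , F⊆P , disjoint) =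
            prime-filter-theorem {F = a ≤_} {I = _≤ b}
              (record { up = λ x≤y a≤x → ≤-trans a≤x x≤y ; ∧-closed = ∧-greatest })
              (a , ≤-refl)
              (record { down = ≤-trans ; ∨-closed = ∨-least })
              (λ a≤x x≤b → a≰b (≤-trans a≤x x≤b)) ℓ
      in record
        { filter = P ; up = IsFilter.up isFilter ; ⊤-closed = F⊆P (maximum a)
        ; ∧-closed = IsFilter.∧-closed isFilter ; proper = λ ⊥∈P → disjoint ⊥∈P (minimum b)
        ; prime = isPrime }
      , F⊆P ≤-refl , λ b∈P → disjoint b∈P ≤-refl
      where open PrimeFilter distributiveLattice

    𝔰-mono : ∀ {a b} → a ≤ b → 𝔰 a ⊆ 𝔰 b
    𝔰-mono a≤b {x} = up x a≤b

    𝔰-reflects-≤ : ∀ {a b} → 𝔰 a ⊆ 𝔰 b → a ≤ b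
    𝔰-reflects-≤ 𝔰a⊆𝔰b = dne λ a≰b → let (x , a∈x , b∉x) = separate a≰b in b∉x (𝔰a⊆𝔰b {x} a∈x)

    -- A finite intersection of rectangles is one rectangle: the first entries are met and the
    -- second joined, the empty list giving `rect ⊤ ⊥`. Hence neighbourhoods need only a single
    -- pair.
    rect-⊆-basic : ∀ ps {x} → x ∈ basic ps → ∃[ a ] ∃[ b ] x ∈ rect a b × rect a b ⊆ basic ps
    rect-⊆-basic [] {x} [] = ⊤ , ⊥ , (⊤-closed x , proper x) , λ _ → []
    rect-⊆-basic ((c , d) ∷ ps) {x} ((c∈x , d∉x) ∷ x∈ps) =
      let (a , b , (a∈x , b∉x) , rect⊆ps) = rect-⊆-basic ps {x} x∈ps in
      c ∧ a , d ∨ b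
      , (∧-closed x c∈x a∈x , λ d∨b∈x → [ d∉x , b∉x ]′ (prime x d∨b∈x))
      , λ {y} (c∧a∈y , d∨b∉y) → let (c∈y , a∈y) = ∈-∧ {y} c∧a∈y in
          (c∈y , d∨b∉y ∘ up y (x≤x∨y _ _)) ∷ rect⊆ps {y} (a∈y , d∨b∉y ∘ up y (y≤x∨y _ _))

    -- Closure and interior by means of rectangles.

    private variable
      u v : Level
      S V : Pred X u

    neighbourhood : ∀ {x} → IsOpen S → x ∈ S → ∃[ a ] ∃[ b ] x ∈ rect a b × rect a b ⊆ S
    neighbourhood {x = x} open-S x∈S =
      let (ps , x∈ps , ps⊆S) = open-S {x} x∈S ; (a , b , x∈ab , ab⊆ps) = rect-⊆-basic ps {x} x∈ps in
      a , b , x∈ab , λ {y} y∈ab → ps⊆S {y} (ab⊆ps {y} y∈ab)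

    int-rect : ∀ {x} a b → x ∈ rect a b → rect a b ⊆ S → x ∈ int S
    int-rect a b x∈ab ab⊆S = ((a , b) ∷ []) , x∈ab ∷ [] , λ { {y} (y∈ab ∷ []) → ab⊆S {y} y∈ab }

    𝔰⊆⇒int : ∀ {x} a → x ∈ 𝔰 a → 𝔰 a ⊆ S → x ∈ int S
    𝔰⊆⇒int {x = x} a a∈x 𝔰a⊆S = int-rect {x = x} a ⊥ (a∈x , proper x) (λ {y} → 𝔰a⊆S {y} ∘ proj₁)

    cl-meets-rect : ∀ {x a b} → x ∈ cl S → x ∈ rect a b → ∃[ y ] y ∈ rect a b × y ∈ S
    cl-meets-rect {a = a} {b} x∈clS x∈ab with x∈clS ((a , b) ∷ []) (x∈ab ∷ [])
    ... | y , y∈ab ∷ [] , y∈S = y , y∈ab , y∈S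

    ∉cl⇒disjoint-rect : ∀ {x} → x ∉ cl S → ∃[ a ] ∃[ b ] x ∈ rect a b × (∀ {y} → y ∈ rect a b → y ∉ S)
    ∉cl⇒disjoint-rect {x = x} x∉clS = dne λ ¬∃ → x∉clS λ ps x∈ps → dne λ ¬meets →
      let (a , b , x∈ab , ab⊆ps) = rect-⊆-basic ps {x} x∈ps in
      ¬∃ (a , b , x∈ab , λ {y} y∈ab y∈S → ¬meets (y , ab⊆ps {y} y∈ab , y∈S))

    cl-closed : (S : Pred X u) → IsClosed (cl S)
    cl-closed S {x} x∉clS = let (a , b , x∈ab , ab∩S=∅) = ∉cl⇒disjoint-rect {S = S} {x} x∉clS in
      int-rect {x = x} a b x∈ab λ {y} y∈ab y∈clS →
        let (z , z∈ab , z∈S) = cl-meets-rect {S = S} {y} y∈clS y∈ab in ab∩S=∅ {z} z∈ab z∈S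

    ⊆-cl : S ⊆ cl S
    ⊆-cl {x = x} x∈S ps x∈ps = x , x∈ps , x∈S

    cl-mono : S ⊆ V → cl S ⊆ cl V
    cl-mono S⊆V x∈clS ps x∈ps = let (y , y∈ps , y∈S) = x∈clS ps x∈ps in y , y∈ps , S⊆V {y} y∈S

    cl-⊆-𝔰 : ∀ {b} → S ⊆ 𝔰 b → cl S ⊆ 𝔰 b
    cl-⊆-𝔰 {S = S} {b = b} S⊆𝔰b {x} x∈clS = dne {P = x ∈ 𝔰 b} λ b∉x →
      let (y , (_ , b∉y) , y∈S) = cl-meets-rect {S = S} {x} x∈clS (⊤-closed x , b∉x) in
      b∉y (S⊆𝔰b {y} y∈S)

    ∁-closed : IsOpen S → IsClosed (∁ S)
    ∁-closed open-S {x} x∉∁S = let (ps , x∈ps , ps⊆S) = open-S {x} (dne x∉∁S) in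
      ps , x∈ps , λ {y} y∈ps y∉S → y∉S (ps⊆S {y} y∈ps)

    int-open : (S : Pred X u) → IsOpen (int S)
    int-open S (ps , x∈ps , ps⊆S) = ps , x∈ps , λ y∈ps → ps , y∈ps , ps⊆S

    int-⊆ : int S ⊆ S
    int-⊆ (_ , x∈ps , ps⊆S) = ps⊆S x∈ps

    -- Compactness and the separation of points from closed sets.

    module _ {j} {J : Pred (Pred X ℓ) j} where
      open PrimeFilter (powerset X ℓ)

      -- If J were proper, a prime filter of sets disjoint from J would converge to the
      -- point x, and no neighbourhood of x could belong to J.
      compactness : IsIdeal J → 𝔰 ⊥ ∈ J →
                    (∀ x → ∃[ a ] ∃[ b ] x ∈ rect a b × rect a b ∈ J) → 𝔰 ⊤ ∈ J
      compactness isIdeal ∅∈J local = dne λ X∉J →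
        let (𝓜 , isFilter , isPrime , F⊆𝓜 , disjoint) =
              prime-filter-theorem {F = λ S → 𝔰 ⊤ ⊆ S}
                (record { up       = λ S⊆S′ X⊆S x∈X → S⊆S′ (X⊆S x∈X)
                        ; ∧-closed = λ X⊆S X⊆S′ x∈X → X⊆S x∈X , X⊆S′ x∈X })
                (𝔰 ⊤ , λ x∈ → x∈) isIdeal (λ {S} X⊆S S∈J → X∉J (IsIdeal.down isIdeal X⊆S S∈J)) ℓ
            x = record
              { filter   = λ a → 𝔰 a ∈ 𝓜
              ; up       = λ a≤b → IsFilter.up isFilter λ {y} → 𝔰-mono a≤b {y}
              ; ⊤-closed = F⊆𝓜 λ x∈ → x∈
              ; ∧-closed = λ a∈ b∈ → IsFilter.up isFilter (λ {y} (a∈y , b∈y) → ∧-closed y a∈y b∈y)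
                                       (IsFilter.∧-closed isFilter a∈ b∈)
              ; proper   = λ ⊥∈ → disjoint ⊥∈ ∅∈J
              ; prime    = λ a∨b∈ → isPrime (IsFilter.up isFilter (λ {y} → prime y) a∨b∈)
              }
            (a , b , (a∈x , b∉x) , ab∈J) = local x
            -- `b∉x` says that `𝔰 b` is not in `𝓜`, so primeness puts its complement there, and
            -- `rect a b` falls into both `𝓜` and `J`.
            ∁b∈𝓜 = [ (λ b∈x → ⊥-elim (b∉x b∈x)) , id ]′
                     (isPrime {𝔰 b} {∁ (𝔰 b)} (F⊆𝓜 λ {y} _ → em-∪ y b))
        in disjoint (IsFilter.∧-closed isFilter a∈x ∁b∈𝓜) ab∈J
        where
        em-∪ : ∀ y b → y ∈ 𝔰 b ∪ ∁ (𝔰 b)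
        em-∪ y b with em {P = y ∈ 𝔰 b}
        ... | yes b∈y = inj₁ b∈y
        ... | no  b∉y = inj₂ b∉y

    -- Near a point `y` of `C`, some `a` in `x` but not in `y` does the job; off `C`, `⊤` does.
    -- Compactness combines finitely many such elements by meets.
    ↓-separate : ∀ {C : Pred X u} {x} → IsClosed C → x ∉ ↓ C → ∃[ a ] x ∈ 𝔰 a × (∀ {y} → y ∈ C → y ∉ 𝔰 a)
    ↓-separate {u} {C} {x} closed x∉↓C =
      let (a , a∈x , X∩C⊆∁a) = compactness {J = J}
            (record
              { down     = λ S⊆S′ (a , a∈x , S′∩C) → a , a∈x , λ y∈S → S′∩C (S⊆S′ y∈S)
              ; ∨-closed = λ (a , a∈x , S∩C) (b , b∈x , S′∩C) → a ∧ b , ∧-closed x a∈x b∈x ,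
                  λ {y} y∈S∪S′ y∈C a∧b∈y → let (a∈y , b∈y) = ∈-∧ {y} a∧b∈y in
                    [ (λ y∈S → S∩C y∈S y∈C a∈y) , (λ y∈S′ → S′∩C y∈S′ y∈C b∈y) ]′ y∈S∪S′ })
            (⊤ , ⊤-closed x , λ {y} ⊥∈y _ _ → proper y ⊥∈y)
            local
      in a , a∈x , λ {y} → X∩C⊆∁a (⊤-closed y)
      where
      J : Pred (Pred X ℓ) _
      J S = ∃[ a ] x ∈ 𝔰 a × (∀ {y} → y ∈ S → y ∈ C → y ∉ 𝔰 a)
      local : ∀ y → ∃[ a ] ∃[ b ] y ∈ rect a b × rect a b ∈ J
      local y with em {P = y ∈ C}
      ... | yes y∈C = let (a , a∈x , a∉y) = ⊈⇒∃ {Q = filter y} λ x≼y → x∉↓C (y , y∈C , x≼y) in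
            ⊤ , a , (⊤-closed y , a∉y) , a , a∈x , λ (_ , a∉z) _ → a∉z
      ... | no y∉C = let (a , b , y∈ab , ab⊆∁C) = neighbourhood closed y∉C in
            a , b , y∈ab , ⊤ , ⊤-closed x , λ z∈ab z∈C → ⊥-elim (ab⊆∁C z∈ab z∈C)

    -- The order dual of `↓-separate`: elements outside `x` are combined by joins, and stay outside
    -- because `x` is prime.
    ↑-separate : ∀ {C : Pred X u} {x} → IsClosed C → x ∉ ↑ C → ∃[ b ] x ∉ 𝔰 b × C ⊆ 𝔰 b
    ↑-separate {u} {C} {x} closed x∉↑C =
      let (b , b∉x , X∩C⊆b) = compactness {J = J}
            (record
              { down     = λ S⊆S′ (b , b∉x , S′∩C) → b , b∉x , λ y∈S → S′∩C (S⊆S′ y∈S)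
              ; ∨-closed = λ (a , a∉x , S∩C) (b , b∉x , S′∩C) →
                  a ∨ b , (λ a∨b∈x → [ a∉x , b∉x ]′ (prime x a∨b∈x)) ,
                  λ {y} y∈S∪S′ y∈C → [ (λ y∈S → up y (x≤x∨y _ _) (S∩C y∈S y∈C))
                                     , (λ y∈S′ → up y (y≤x∨y _ _) (S′∩C y∈S′ y∈C)) ]′ y∈S∪S′ })
            (⊥ , proper x , λ ⊥∈y _ → ⊥∈y)
            local
      in b , b∉x , λ {y} → X∩C⊆b (⊤-closed y)
      where
      J : Pred (Pred X ℓ) _
      J S = ∃[ b ] x ∉ 𝔰 b × (∀ {y} → y ∈ S → y ∈ C → y ∈ 𝔰 b)
      local : ∀ y → ∃[ a ] ∃[ b ] y ∈ rect a b × rect a b ∈ J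
      local y with em {P = y ∈ C}
      ... | yes y∈C = let (b , b∈y , b∉x) = ⊈⇒∃ {Q = filter x} λ y≼x → x∉↑C (y , y∈C , y≼x) in
            b , ⊥ , (b∈y , proper y) , b , b∉x , λ (b∈z , _) _ → b∈z
      ... | no y∉C = let (a , b , y∈ab , ab⊆∁C) = neighbourhood closed y∉C in
            a , b , y∈ab , ⊥ , proper x , λ z∈ab z∈C → ⊥-elim (ab⊆∁C z∈ab z∈C)

    -- Open upsets, `int₁` and `cl₂` in terms of the sets `𝔰 a`.

    ∁↓-𝔰 : ∀ {C : Pred X u} {x} → IsClosed C → x ∉ ↓ C → ∃[ a ] x ∈ 𝔰 a × 𝔰 a ⊆ ∁ (↓ C)
    ∁↓-𝔰 {C = C} {x} closed x∉↓C =
      let (a , a∈x , a∉C) = ↓-separate {C = C} {x} (λ {y} → closed {y}) x∉↓C in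
      a , a∈x , λ a∈y (z , z∈C , y≼z) → a∉C {z} z∈C (y≼z a∈y)

    -- As `S` is an upset, `x` lies below no point of its closed complement, and `↓-separate`
    -- applies. So an open upset is a union of sets `𝔰 a`.
    open-upset-𝔰 : ∀ {x} → IsOpen S → IsUpset S → x ∈ S → ∃[ a ] x ∈ 𝔰 a × 𝔰 a ⊆ S
    open-upset-𝔰 {S = S} {x} open-S upset x∈S =
      let (a , a∈x , a∉∁S) = ↓-separate {C = ∁ S} {x} (∁-closed {S = S} λ {y} → open-S {y})
                               (λ (y , y∉S , x≼y) → y∉S (upset {x} {y} x≼y x∈S)) in
      a , a∈x , λ {y} a∈y → dne {P = y ∈ S} λ y∉S → a∉∁S {y} y∉S a∈y

    -- Separates `x` from the closed complement of `int S`. With `𝔰⇒int₁`, `int₁ S` becomes the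
    -- union of the `𝔰 a` inside `S`, the form used from here on.
    int₁⇒𝔰 : ∀ {x} → x ∈ int₁ S → ∃[ a ] x ∈ 𝔰 a × 𝔰 a ⊆ S
    int₁⇒𝔰 {S = S} {x} x∈int₁ =
      let (a , a∈x , a∉∁int) = ↓-separate {C = ∁ (int S)} {x}
            (λ {y} → ∁-closed {S = int S} (λ {z} → int-open S {z}) {y}) x∈int₁ in
      a , a∈x , λ {y} a∈y → int-⊆ {x = y} (dne {P = y ∈ int S} λ y∉int → a∉∁int {y} y∉int a∈y)

    𝔰⇒int₁ : ∀ {x} a → x ∈ 𝔰 a → 𝔰 a ⊆ S → x ∈ int₁ S
    𝔰⇒int₁ a a∈x 𝔰a⊆S (y , y∉int , x≼y) = y∉int (𝔰⊆⇒int {x = y} a (x≼y a∈x) 𝔰a⊆S)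

    int₁-⊆ : int₁ S ⊆ S
    int₁-⊆ {x = x} x∈int₁ = let (a , a∈x , 𝔰a⊆S) = int₁⇒𝔰 {x = x} x∈int₁ in 𝔰a⊆S {x} a∈x

    int₁-mono : S ⊆ V → int₁ S ⊆ int₁ V
    int₁-mono S⊆V {x} x∈int₁ = let (a , a∈x , 𝔰a⊆S) = int₁⇒𝔰 {x = x} x∈int₁ in
      𝔰⇒int₁ {x = x} a a∈x λ {y} a∈y → S⊆V {y} (𝔰a⊆S {y} a∈y)

    cl₂-⊆-𝔰 : ∀ {b} → S ⊆ 𝔰 b → cl₂ S ⊆ 𝔰 b
    cl₂-⊆-𝔰 {b = b} S⊆𝔰b (y , y∈clS , y≼x) = y≼x (cl-⊆-𝔰 {b = b} S⊆𝔰b {y} y∈clS)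

    -- By `↑-separate`, a point outside `cl₂ S` is excluded by some `𝔰 b` containing `S`. With
    -- `cl₂-⊆-𝔰`, `cl₂ S` becomes the intersection of all such `𝔰 b`.
    ∈-cl₂ : ∀ {x} → (∀ b → S ⊆ 𝔰 b → x ∈ 𝔰 b) → x ∈ cl₂ S
    ∈-cl₂ {S = S} {x} bounds = dne λ x∉cl₂ →
      let (b , b∉x , clS⊆𝔰b) = ↑-separate {C = cl S} {x} (λ {y} → cl-closed S {y}) x∉cl₂ in
      b∉x (bounds b λ {y} y∈S → clS⊆𝔰b {y} (⊆-cl {x = y} y∈S))

    ⊆-cl₂ : S ⊆ cl₂ S
    ⊆-cl₂ {x = x} x∈S = x , ⊆-cl {x = x} x∈S , id

    cl₂-mono : S ⊆ V → cl₂ S ⊆ cl₂ V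
    cl₂-mono S⊆V (y , y∈clS , y≼x) = y , cl-mono S⊆V {y} y∈clS , y≼x

    ↑-upset : (S : Pred X u) → IsUpset (↑ S)
    ↑-upset S x≼x′ (y , y∈S , y≼x) = y , y∈S , λ a∈y → x≼x′ (y≼x a∈y)

    ≐𝔰⇒clopen-upset : ∀ a → S ≐ 𝔰 a → IsClopenUpset S
    ≐𝔰⇒clopen-upset a (S⊆𝔰a , 𝔰a⊆S) =
        ( (λ {x} x∈S → 𝔰⊆⇒int {x = x} a (S⊆𝔰a {x} x∈S) λ {y} → 𝔰a⊆S {y})
        , λ {x} x∉S → int-rect {x = x} ⊤ a (⊤-closed x , λ a∈x → x∉S (𝔰a⊆S {x} a∈x))
                        λ {y} (_ , a∉y) y∈S → a∉y (S⊆𝔰a {y} y∈S))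
      , λ {x} {y} x≼y x∈S → 𝔰a⊆S {y} (x≼y (S⊆𝔰a {x} x∈S))

    -- By compactness finitely many of the `𝔰 a` inside `S` cover it, and their union is `𝔰` of the
    -- join.
    clopen-upset⇒≐𝔰 : IsClopenUpset S → ∃[ a ] S ≐ 𝔰 a
    clopen-upset⇒≐𝔰 {S = S} ((open-S , closed-S) , upset) =
      let (a , 𝔰a⊆S , X∩S⊆𝔰a) = compactness {J = J}
            (record
              { down     = λ T⊆T′ (a , 𝔰a⊆S , T′∩S) → a , (λ {y} → 𝔰a⊆S {y}) , λ {y} y∈T → T′∩S {y} (T⊆T′ y∈T)
              ; ∨-closed = λ (a , 𝔰a⊆S , T∩S) (b , 𝔰b⊆S , T′∩S) → a ∨ b ,
                  (λ {y} a∨b∈y → [ 𝔰a⊆S {y} , 𝔰b⊆S {y} ]′ (prime y a∨b∈y)) ,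
                  λ {y} y∈T∪T′ y∈S → [ (λ y∈T → up y (x≤x∨y _ _) (T∩S {y} y∈T y∈S))
                                     , (λ y∈T′ → up y (y≤x∨y _ _) (T′∩S {y} y∈T′ y∈S)) ]′ y∈T∪T′ })
            (⊥ , (λ {y} ⊥∈y → ⊥-elim (proper y ⊥∈y)) , λ ⊥∈y _ → ⊥∈y)
            local
      in a , (λ {x} → X∩S⊆𝔰a {x} (⊤-closed x)) , λ {x} → 𝔰a⊆S {x}
      where
      J : Pred (Pred X ℓ) _
      J T = ∃[ a ] 𝔰 a ⊆ S × (∀ {y} → y ∈ T → y ∈ S → y ∈ 𝔰 a)
      local : ∀ y → ∃[ a ] ∃[ b ] y ∈ rect a b × rect a b ∈ J
      local y with em {P = y ∈ S}
      ... | yes y∈S = let (a , a∈y , 𝔰a⊆S) = open-upset-𝔰 {S = S} {y} open-S upset y∈S in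
            a , ⊥ , (a∈y , proper y) , a , (λ {z} → 𝔰a⊆S {z}) , λ (a∈z , _) _ → a∈z
      ... | no y∉S = let (a , b , y∈ab , ab⊆∁S) = neighbourhood {S = ∁ S} {y} (λ {x} → closed-S {x}) y∉S in
            a , b , y∈ab , ⊥ , (λ {z} ⊥∈z → ⊥-elim (proper z ⊥∈z))
            , λ {z} z∈ab z∈S → ⊥-elim (ab⊆∁S {z} z∈ab z∈S)

    -- Clopen sets and the complements of their downsets.

    ↥ : Pred X ℓ → 𝓟X
    ↥ S = Lift (suc ℓ) ∘ S

    𝔰-clopen-upset : ∀ a → IsClopenUpset (↥ (𝔰 a))
    𝔰-clopen-upset a = ≐𝔰⇒clopen-upset a (lower , lift)

    ∧-swap : ∀ {a b c} → a ∧ b ≤ c → b ∧ a ≤ c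
    ∧-swap = ≤-trans (reflexive (∧-comm _ _))

    rect-closed : ∀ a b → IsClosed (↥ (rect a b))
    rect-closed a b {x} x∉ab with em {P = x ∈ 𝔰 a}
    ... | no a∉x  = int-rect {x = x} ⊤ a (⊤-closed x , a∉x) λ { (_ , a∉y) (lift (a∈y , _)) → a∉y a∈y }
    ... | yes a∈x = 𝔰⊆⇒int {x = x} b (dne {P = x ∈ 𝔰 b} λ b∉x → x∉ab (lift (a∈x , b∉x)))
                      λ { b∈y (lift (_ , b∉y)) → b∉y b∈y }

    rect-open : ∀ a b → IsOpen (↥ (rect a b))
    rect-open a b {x} (lift x∈ab) = int-rect {x = x} a b x∈ab lift

    ∁↓-open : {C : Pred X u} → IsClosed C → IsOpen (∁ (↓ C))
    ∁↓-open {C = C} closed {x} x∉↓C =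
      let (a , a∈x , 𝔰a⊆) = ∁↓-𝔰 {C = C} {x} (λ {y} → closed {y}) x∉↓C in
      𝔰⊆⇒int {x = x} a a∈x (λ {y} → 𝔰a⊆ {y})

    ∁↓-upset : (C : Pred X u) → IsUpset (∁ (↓ C))
    ∁↓-upset C x≼y x∉↓C (z , z∈C , y≼z) = x∉↓C (z , z∈C , λ a∈x → y≼z (x≼y a∈x))

    ∁↓-antitone : S ⊆ V → ∁ (↓ V) ⊆ ∁ (↓ S)
    ∁↓-antitone S⊆V x∉↓V (y , y∈S , x≼y) = x∉↓V (y , S⊆V {y} y∈S , λ a∈x → x≼y a∈x)

    ∁↓-∪ : (∁ (↓ S) ∩ ∁ (↓ V)) ⊆ ∁ (↓ (S ∪ V))
    ∁↓-∪ (x∉↓S , x∉↓V) (y , inj₁ y∈S , x≼y) = x∉↓S (y , y∈S , λ a∈x → x≼y a∈x)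
    ∁↓-∪ (x∉↓S , x∉↓V) (y , inj₂ y∈V , x≼y) = x∉↓V (y , y∈V , λ a∈x → x≼y a∈x)

    -- ∁ ∘ ↓ turns unions into intersections, and by compactness a clopen set
    -- is a finite union of rectangles.
    ∁↓-induction : {Q : Pred 𝓟X q} →
      (∀ {W W′} → W ≐ W′ → Q W → Q W′) →
      (∀ {W W′} → Q W → Q W′ → Q (W ∩ W′)) →
      (∀ a b → Q (∁ (↓ (↥ (rect a b))))) →
      ∀ (C : 𝓟X) → IsClopen C → Q (∁ (↓ C))
    ∁↓-induction {Q = Q} resp ∩-closed rects C (open-C , closed-C) =
      let (T , T⊆C , X∩C⊆T , QT) = compactness {J = J}
            (record
              { down     = λ S⊆S′ (T , T⊆C , S′∩C , QT) →
                  T , (λ {y} → T⊆C {y}) , (λ {y} y∈S → S′∩C {y} (S⊆S′ {y} y∈S)) , QT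
              ; ∨-closed = λ (T , T⊆C , S∩C , QT) (T′ , T′⊆C , S′∩C , QT′) →
                  (T ∪ T′) , (λ {y} → [ T⊆C {y} , T′⊆C {y} ]′)
                  , (λ {y} y∈S∪S′ y∈C → [ (λ y∈S → inj₁ (S∩C {y} y∈S y∈C))
                                        , (λ y∈S′ → inj₂ (S′∩C {y} y∈S′ y∈C)) ]′ y∈S∪S′)
                  , resp ( (λ {x} → ∁↓-∪ {S = T} {V = T′} {x})
                         , (λ {x} x∉ → ∁↓-antitone {S = T} {V = T ∪ T′} inj₁ {x} x∉
                                     , ∁↓-antitone {S = T′} {V = T ∪ T′} inj₂ {x} x∉))
                         (∩-closed QT QT′) })
            ( ↥ (rect ⊥ ⊥) , (λ {y} y∈∅ → ⊥-elim (proper y (proj₁ (lower y∈∅))))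
            , (λ {y} ⊥∈y _ → ⊥-elim (proper y ⊥∈y)) , rects ⊥ ⊥)
            (λ y → local y em)
      in resp ( (λ {x} → ∁↓-antitone {S = C} {V = T} (λ {y} → X∩C⊆T {y} (⊤-closed y)) {x})
              , (λ {x} → ∁↓-antitone {S = T} {V = C} (λ {y} → T⊆C {y}) {x})) QT
      where
      J : Pred (Pred X ℓ) _
      -- `T` is the union of the rectangles collected so far: inside `C` and covering the part of
      -- `C` in `S`, hence equal to `C` once `S` is the whole space.
      J S = Σ 𝓟X λ T → T ⊆ C × (∀ {y} → y ∈ S → y ∈ C → y ∈ T) × Q (∁ (↓ T))
      local : ∀ y → Dec (y ∈ C) → ∃[ a ] ∃[ b ] y ∈ rect a b × rect a b ∈ J
      local y (yes y∈C) =
        let (a , b , y∈ab , ab⊆C) = neighbourhood {S = C} {y} (λ {x} → open-C {x}) y∈C in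
        a , b , y∈ab , ↥ (rect a b) , (λ {z} z∈ab → ab⊆C {z} (lower z∈ab))
        , (λ {z} z∈ab _ → lift z∈ab) , rects a b
      local y (no y∉C) =
        let (a , b , y∈ab , ab⊆∁C) = neighbourhood {S = ∁ C} {y} (λ {x} → closed-C {x}) y∉C in
        -- This neighbourhood misses `C`, so the empty set, written `rect ⊥ ⊥`, covers its part of
        -- `C`.
        a , b , y∈ab , ↥ (rect ⊥ ⊥) , (λ {z} z∈∅ → ⊥-elim (proper z (proj₁ (lower z∈∅))))
        , (λ {z} z∈ab z∈C → ⊥-elim (ab⊆∁C {z} z∈ab z∈C)) , rects ⊥ ⊥

    -- Joins and generated D-ideals in terms of closures.

    private variable
      I : Set ℓ
      f : I → Carrier

    ⋃𝔰 : (I → Carrier) → 𝓟X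
    ⋃𝔰 f = ⋃ _ λ i → ↥ (𝔰 (f i))

    ⋃𝔰-⊆ : ∀ {b} → (∀ i → f i ≤ b) → ⋃𝔰 f ⊆ 𝔰 b
    ⋃𝔰-⊆ f≤b {x} (i , lift fi∈x) = up x (f≤b i) fi∈x

    ⋃𝔰-⊆⁻¹ : ∀ {b} → ⋃𝔰 f ⊆ 𝔰 b → ∀ i → f i ≤ b
    ⋃𝔰-⊆⁻¹ ⋃⊆𝔰b i = 𝔰-reflects-≤ λ {x} fi∈x → ⋃⊆𝔰b {x} (i , lift fi∈x)

    ⋃𝔰-open : (f : I → Carrier) → IsOpen (⋃𝔰 f)
    ⋃𝔰-open f {x} (i , lift fi∈x) = 𝔰⊆⇒int {x = x} (f i) fi∈x λ fi∈y → i , lift fi∈y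

    ⋃𝔰-upset : (f : I → Carrier) → IsUpset (⋃𝔰 f)
    ⋃𝔰-upset f x≼y (i , lift fi∈x) = i , lift (x≼y fi∈x)

    -- The intersection of all relative annihilators containing every `f i`. By `hullᴰ-⊑` it is the
    -- D-ideal generated by `f`; this description avoids quantifying over D-ideals and so stays at
    -- level `ℓ`.
    hull : (I → Carrier) → Pred Carrier ℓ
    hull f c = ∀ a b → (∀ i → a ∧ f i ≤ b) → a ∧ c ≤ b

    -- A point outside the closure has a neighbourhood `rect a b` disjoint from every `𝔰 (f i)`,
    -- which says that `a ∧ f i ≤ b` for all `i`; the hull then gives `a ∧ c ≤ b`.
    hull⇒𝔰⊆cl : ∀ {c} → c ∈ hull f → 𝔰 c ⊆ cl (⋃𝔰 f)
    hull⇒𝔰⊆cl {f = f} c∈hull {x} c∈x = dne {P = x ∈ cl (⋃𝔰 f)} λ x∉cl →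
      let (a , b , (a∈x , b∉x) , disjoint) = ∉cl⇒disjoint-rect {S = ⋃𝔰 f} {x} x∉cl in
      b∉x (up x (c∈hull a b λ i → 𝔰-reflects-≤ λ {y} a∧fi∈y →
            let (a∈y , fi∈y) = ∈-∧ {y} a∧fi∈y in
            dne {P = y ∈ 𝔰 b} λ b∉y → disjoint {y} (a∈y , b∉y) (i , lift fi∈y))
          (∧-closed x a∈x c∈x))

    𝔰⊆cl⇒hull : ∀ {c} → 𝔰 c ⊆ cl (⋃𝔰 f) → c ∈ hull f
    𝔰⊆cl⇒hull {f = f} {c} 𝔰c⊆cl a b a∧f≤b = 𝔰-reflects-≤ λ {x} a∧c∈x →
      let (a∈x , c∈x) = ∈-∧ {x} a∧c∈x in
      dne {P = x ∈ 𝔰 b} λ b∉x →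
        let (y , (a∈y , b∉y) , (i , lift fi∈y)) = cl-meets-rect {S = ⋃𝔰 f} {x} (𝔰c⊆cl {x} c∈x) (a∈x , b∉x) in
        b∉y (up y (a∧f≤b i) (∧-closed y a∈y fi∈y))

    ∈-hull : ∀ i → f i ∈ hull f
    ∈-hull i a b a∧f≤b = a∧f≤b i

    hull-least : ∀ {b c} → (∀ i → f i ≤ b) → c ∈ hull f → c ≤ b
    hull-least {b = b} f≤b c∈hull = ≤-trans (∧-greatest (maximum _) ≤-refl)
      (c∈hull ⊤ b λ i → ≤-trans (x∧y≤y _ _) (f≤b i))

    -- Membership of `s` in the hull is the leastness half of distributivity for all `a` at once;
    -- the instance `⊤`, in `hull-least`, makes `s` itself least.
    distributive-lub⇔hull : ∀ {s} → IsDistributiveLub f s ⇔ ((∀ i → f i ≤ s) × s ∈ hull f)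
    distributive-lub⇔hull = mk⇔
      (λ (lub , dist) → proj₁ lub , λ a → proj₂ (dist a))
      (λ (f≤s , s∈hull) → (f≤s , λ z f≤z → hull-least f≤z s∈hull)
                        , λ a → (λ i → ∧-monotonic ≤-refl (f≤s i)) , s∈hull a)

    distributive-lub⇔cl : ∀ {s} → IsDistributiveLub f s ⇔ cl (⋃𝔰 f) ≐ 𝔰 s
    distributive-lub⇔cl {f = f} {s} = mk⇔
      (λ dlub → let (f≤s , s∈hull) = to dlub in
        (λ {x} → cl-⊆-𝔰 {S = ⋃𝔰 f} {s} (λ {y} → ⋃𝔰-⊆ f≤s {y}) {x}) , (λ {x} → hull⇒𝔰⊆cl s∈hull {x}))
      (λ (cl⊆𝔰s , 𝔰s⊆cl) → from
        ( ⋃𝔰-⊆⁻¹ (λ {x} x∈ → cl⊆𝔰s {x} (⊆-cl {x = x} x∈))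
        , 𝔰⊆cl⇒hull (λ {x} → 𝔰s⊆cl {x})))
      where open Equivalence (distributive-lub⇔hull {f = f} {s})

    -- As `cl₂` is the intersection of the sets `𝔰 b` above, the equation says that `s` and `f` have
    -- the same upper bounds.
    lub⇔cl₂ : ∀ {s} → IsLub _≤_ f s ⇔ cl₂ (⋃𝔰 f) ≐ 𝔰 s
    lub⇔cl₂ {f = f} {s} = mk⇔
      (λ (f≤s , least) →
          (λ {x} → cl₂-⊆-𝔰 {S = ⋃𝔰 f} {s} (λ {y} → ⋃𝔰-⊆ f≤s {y}) {x})
        , (λ {x} s∈x → ∈-cl₂ {S = ⋃𝔰 f} {x} λ b ⋃⊆𝔰b →
             up x (least b (⋃𝔰-⊆⁻¹ λ {y} → ⋃⊆𝔰b {y})) s∈x))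
      (λ (cl₂⊆𝔰s , 𝔰s⊆cl₂) →
          ⋃𝔰-⊆⁻¹ (λ {x} x∈ → cl₂⊆𝔰s {x} (⊆-cl₂ {x = x} x∈))
        , λ z f≤z → 𝔰-reflects-≤ λ {x} s∈x →
            cl₂-⊆-𝔰 {S = ⋃𝔰 f} {z} (λ {y} → ⋃𝔰-⊆ f≤z {y}) {x} (𝔰s⊆cl₂ {x} s∈x))

    hullᴰ : (I → Carrier) → DIdeal
    hullᴰ f = record
      { member = hull f
      ; down   = λ x≤y y∈hull a b a∧f≤b → ≤-trans (∧-monotonic ≤-refl x≤y) (y∈hull a b a∧f≤b)
      ; joins  = λ S s S⊆hull (_ , dist) a b a∧f≤b → proj₂ (dist a) b λ (x , x∈S) → S⊆hull x∈S a b a∧f≤b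
      }

    -- An element c of the hull is the distributive join of the elements c ∧ f i.
    hullᴰ-⊑ : ∀ D → (∀ i → f i ∈ member D) → hullᴰ f ⊑ D
    hullᴰ-⊑ {f = f} D f∈D {c} c∈hull = joins D (λ x → ∃[ i ] x ≡ c ∧ f i) c
      (λ { (i , refl) → down D (x∧y≤y c (f i)) (f∈D i) })
      ( ( (λ { (_ , i , refl) → x∧y≤x c (f i) })
        , λ z ≤z → ≤-trans (∧-greatest ≤-refl ≤-refl) (c∈hull c z λ i → ≤z (_ , i , refl)))
      , λ a → (λ { (_ , i , refl) → ∧-monotonic ≤-refl (x∧y≤x c (f i)) })
            -- Reassociating `a ∧ (c ∧ f i)` lets the hull condition be used with `a ∧ c` as its
            -- parameter.
            , λ z ≤z → ≤-trans (∧-greatest ≤-refl (x∧y≤y a c))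
                (c∈hull (a ∧ c) z λ i → ≤-trans (reflexive (∧-assoc a c (f i))) (≤z (_ , i , refl))))

    -- For the inclusion from right to left the free parameter `a` absorbs `c` and then `f i`, so
    -- the two hull conditions can be used one after the other.
    hull-∩ : ∀ {I J : Set ℓ} (f : I → Carrier) (g : J → Carrier) →
             hull {I × J} (λ (i , j) → f i ∧ g j) ≐ hull f ∩ hull g
    hull-∩ f g =
        (λ c∈ → (λ a b a∧f≤b → c∈ a b λ (i , j) →
                 ≤-trans (∧-monotonic ≤-refl (x∧y≤x (f i) (g j))) (a∧f≤b i))
              , (λ a b a∧g≤b → c∈ a b λ (i , j) →
                 ≤-trans (∧-monotonic ≤-refl (x∧y≤y (f i) (g j))) (a∧g≤b j)))
      , λ {c} (c∈f , c∈g) a b a∧f∧g≤b → ≤-trans (∧-greatest ≤-refl (x∧y≤y a c))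
          (c∈f (a ∧ c) b λ i → ≤-trans (∧-greatest
              (∧-greatest (≤-trans (x∧y≤x _ _) (x∧y≤x a c)) (x∧y≤y _ _))
              (≤-trans (x∧y≤x _ _) (x∧y≤y a c)))
            (c∈g (a ∧ f i) b λ j → ≤-trans (reflexive (∧-assoc a (f i) (g j))) (a∧f∧g≤b (i , j))))

    -- Normal ideals, DM-sets and `BL` under the correspondence of lattice elements with open
    -- upsets.

    ≼-refl : ∀ x → x ≼ x
    ≼-refl x a∈x = a∈x

    infix 4 _≙_
    -- When `W` is an open upset it is the union of the `𝔰 c` with `c` in `N`, so each of `N` and
    -- `W` determines the other.
    _≙_ : Pred Carrier ℓ → 𝓟X → Set (suc ℓ)
    N ≙ W = ∀ c → c ∈ N ⇔ 𝔰 c ⊆ W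

    -- A point of `𝔰 c` below some `y` in `rect a b` would put `a ∧ c`, but not `b`, into `y`;
    -- conversely a point containing `a ∧ c` but not `b` lies below itself.
    annihilator-≙ : ∀ a b → member (annihilator a b) ≙ ∁ (↓ (↥ (rect a b)))
    annihilator-≙ a b c = mk⇔
      (λ a∧c≤b {x} c∈x (y , lift (a∈y , b∉y) , x≼y) → b∉y (up y a∧c≤b (∧-closed y a∈y (x≼y c∈x))))
      (λ 𝔰c⊆ → 𝔰-reflects-≤ λ {x} a∧c∈x → let (a∈x , c∈x) = ∈-∧ {x} a∧c∈x in
        dne {P = x ∈ 𝔰 b} λ b∉x → 𝔰c⊆ {x} c∈x (x , lift (a∈x , b∉x) , λ {d} → ≼-refl x {d}))

    -- An open upset is a union of sets `𝔰 a`, each inside `cl₂ W`; this gives the inclusion of `W`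
    -- in `int₁ (cl₂ W)`.
    DM-intro : (W : 𝓟X) → IsOpen W → IsUpset W → int₁ (cl₂ W) ⊆ W → DM W
    DM-intro W open-W upset closed =
      (λ {x} → open-W {x}) , (λ {x} {y} → upset {x} {y}) , (λ {x} → closed {x}) , λ {x} x∈W →
        let (a , a∈x , 𝔰a⊆W) =
              open-upset-𝔰 {S = W} {x} (λ {y} → open-W {y}) (λ {y} {z} → upset {y} {z}) x∈W in
        𝔰⇒int₁ {S = cl₂ W} {x} a a∈x λ {y} a∈y → ⊆-cl₂ {S = W} {y} (𝔰a⊆W {y} a∈y)

    DM-resp : {W W′ : 𝓟X} → W ≐ W′ → DM W → DM W′
    DM-resp {W} {W′} (W⊆W′ , W′⊆W) (open-W , upset , closed , _) = DM-intro W′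
      (λ {x} x∈W′ → let (ps , x∈ps , ps⊆W) = open-W {x} (W′⊆W {x} x∈W′) in
        ps , x∈ps , λ {y} y∈ps → W⊆W′ {y} (ps⊆W {y} y∈ps))
      (λ {x} {y} x≼y x∈W′ → W⊆W′ {y} (upset {x} {y} x≼y (W′⊆W {x} x∈W′)))
      (λ {x} x∈ → W⊆W′ {x} (closed {x} (int₁-mono {S = cl₂ W′} {V = cl₂ W}
        (λ {y} → cl₂-mono {S = W′} {V = W} (λ {z} → W′⊆W {z}) {y}) {x} x∈)))

    DM-∩ : {W W′ : 𝓟X} → DM W → DM W′ → DM (W ∩ W′)
    DM-∩ {W} {W′} (open-W , upset , closed , _) (open-W′ , upset′ , closed′ , _) = DM-intro (W ∩ W′)
      (λ {x} (x∈W , x∈W′) →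
        let (a , a∈x , 𝔰a⊆W) =
              open-upset-𝔰 {S = W} {x} (λ {y} → open-W {y}) (λ {y} {z} → upset {y} {z}) x∈W
            (b , b∈x , 𝔰b⊆W′) =
              open-upset-𝔰 {S = W′} {x} (λ {y} → open-W′ {y}) (λ {y} {z} → upset′ {y} {z}) x∈W′
        in 𝔰⊆⇒int {x = x} (a ∧ b) (∧-closed x a∈x b∈x) λ {y} a∧b∈y →
             let (a∈y , b∈y) = ∈-∧ {y} a∧b∈y in 𝔰a⊆W {y} a∈y , 𝔰b⊆W′ {y} b∈y)
      (λ {x} {y} x≼y (x∈W , x∈W′) → upset {x} {y} x≼y x∈W , upset′ {x} {y} x≼y x∈W′)
      (λ {x} x∈ →
          closed {x} (int₁-mono {S = cl₂ (W ∩ W′)} {V = cl₂ W}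
            (λ {y} → cl₂-mono {S = W ∩ W′} {V = W} proj₁ {y}) {x} x∈)
        , closed′ {x} (int₁-mono {S = cl₂ (W ∩ W′)} {V = cl₂ W′}
            (λ {y} → cl₂-mono {S = W ∩ W′} {V = W′} proj₂ {y}) {x} x∈))

    module _ {N : Pred Carrier ℓ} {W : 𝓟X} (open-W : IsOpen W) (upset : IsUpset W) (N≙W : N ≙ W) where

      private
        to : ∀ {c} → c ∈ N → 𝔰 c ⊆ W
        to = Equivalence.to (N≙W _)
        from : ∀ {c} → 𝔰 c ⊆ W → c ∈ N
        from = Equivalence.from (N≙W _)

        W⇒𝔰 : ∀ {x} → x ∈ W → ∃[ a ] x ∈ 𝔰 a × 𝔰 a ⊆ W
        W⇒𝔰 {x} = open-upset-𝔰 {S = W} {x} (λ {y} → open-W {y}) (λ {y} {z} → upset {y} {z})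

      ≙-upperBound⇒ : ∀ {b} → b ∈ upperBounds N → W ⊆ 𝔰 b
      ≙-upperBound⇒ N≤b {x} x∈W = let (a , a∈x , 𝔰a⊆W) = W⇒𝔰 {x} x∈W in
        up x (N≤b (from λ {y} → 𝔰a⊆W {y})) a∈x

      ≙-upperBound⇐ : ∀ {b} → W ⊆ 𝔰 b → b ∈ upperBounds N
      ≙-upperBound⇐ W⊆𝔰b y∈N = 𝔰-reflects-≤ λ {x} y∈x → W⊆𝔰b {x} (to y∈N {x} y∈x)

      -- The upper bounds of `N` are the `b` with `W ⊆ 𝔰 b`, so their lower bounds are the `c` with
      -- `𝔰 c ⊆ cl₂ W`, which correspond to `int₁ (cl₂ W)`.
      normal⇔DM : IsNormalIdeal N ⇔ DM W
      normal⇔DM = mk⇔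
        (λ (_ , _ , N^ul⊆N) → DM-intro W (λ {x} → open-W {x}) (λ {x} {y} → upset {x} {y}) λ {x} x∈ →
          let (a , a∈x , 𝔰a⊆cl₂) = int₁⇒𝔰 {S = cl₂ W} {x} x∈ in
          to (N^ul⊆N {a} λ {b} N≤b → 𝔰-reflects-≤ λ {y} a∈y →
               cl₂-⊆-𝔰 {S = W} {b} (λ {z} → ≙-upperBound⇒ N≤b {z}) {y} (𝔰a⊆cl₂ {y} a∈y)) {x} a∈x)
        (λ (_ , _ , closed , _) →
            (λ c≤d d∈N → from λ {x} c∈x → to d∈N {x} (up x c≤d c∈x))
          , (λ c∈N N≤b → N≤b c∈N)
          , λ {c} c∈N^ul → from λ {x} c∈x → closed {x} (𝔰⇒int₁ {S = cl₂ W} {x} c c∈x λ {y} c∈y →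
              ∈-cl₂ {S = W} {y} λ b W⊆𝔰b → up y (c∈N^ul (≙-upperBound⇐ λ {z} → W⊆𝔰b {z})) c∈y))

      -- `hull f` corresponds to `int₁ (cl (⋃𝔰 f))` just as `N` does to `W`, and the correspondence
      -- is faithful on both sides.
      ≙-hull⇔BL : (f : I → Carrier) → N ≐ hull f ⇔ W ≐ int₁ (cl (⋃𝔰 f))
      ≙-hull⇔BL f = mk⇔
        (λ (N⊆ , N⊇) →
            (λ {x} x∈W → let (a , a∈x , 𝔰a⊆W) = W⇒𝔰 {x} x∈W in
              𝔰⇒int₁ {S = cl (⋃𝔰 f)} {x} a a∈x λ {y} → hull⇒𝔰⊆cl (N⊆ (from λ {z} → 𝔰a⊆W {z})) {y})
          , (λ {x} x∈ → let (a , a∈x , 𝔰a⊆cl) = int₁⇒𝔰 {S = cl (⋃𝔰 f)} {x} x∈ in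
              to (N⊇ (𝔰⊆cl⇒hull λ {y} → 𝔰a⊆cl {y})) {x} a∈x))
        (λ (W⊆ , W⊇) →
            (λ c∈N → 𝔰⊆cl⇒hull λ {x} c∈x → int₁-⊆ {S = cl (⋃𝔰 f)} {x} (W⊆ {x} (to c∈N {x} c∈x)))
          , (λ {c} c∈hull → from λ {x} c∈x →
              W⊇ {x} (𝔰⇒int₁ {S = cl (⋃𝔰 f)} {x} c c∈x λ {y} → hull⇒𝔰⊆cl c∈hull {y})))

    -- The topological form of `hull-∩`, needed to intersect members of `BL`.
    int₁cl-∩ : ∀ {I J : Set ℓ} (f : I → Carrier) (g : J → Carrier) →
      int₁ (cl (⋃𝔰 {I = I × J} λ (i , j) → f i ∧ g j)) ≐ int₁ (cl (⋃𝔰 f)) ∩ int₁ (cl (⋃𝔰 g))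
    int₁cl-∩ {I} {J} f g =
        (λ {x} x∈ → let (a , a∈x , 𝔰a⊆) = int₁⇒𝔰 {S = cl (⋃𝔰 h)} {x} x∈
                        (a∈f , a∈g) = proj₁ (hull-∩ f g) (𝔰⊆cl⇒hull λ {y} → 𝔰a⊆ {y}) in
            𝔰⇒int₁ {S = cl (⋃𝔰 f)} {x} a a∈x (λ {y} → hull⇒𝔰⊆cl a∈f {y})
          , 𝔰⇒int₁ {S = cl (⋃𝔰 g)} {x} a a∈x (λ {y} → hull⇒𝔰⊆cl a∈g {y}))
      , (λ {x} (x∈f , x∈g) →
          let (a , a∈x , 𝔰a⊆) = int₁⇒𝔰 {S = cl (⋃𝔰 f)} {x} x∈f
              (b , b∈x , 𝔰b⊆) = int₁⇒𝔰 {S = cl (⋃𝔰 g)} {x} x∈g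
          in 𝔰⇒int₁ {S = cl (⋃𝔰 h)} {x} (a ∧ b) (∧-closed x a∈x b∈x) λ {y} →
               hull⇒𝔰⊆cl (proj₂ (hull-∩ f g)
                 ( 𝔰⊆cl⇒hull (λ {z} a∧b∈z → 𝔰a⊆ {z} (proj₁ (∈-∧ {z} a∧b∈z)))
                 , 𝔰⊆cl⇒hull (λ {z} a∧b∈z → 𝔰b⊆ {z} (proj₂ (∈-∧ {z} a∧b∈z))))) {y})
      where
      h : I × J → Carrier
      h (i , j) = f i ∧ g j

    -- Completeness and Heyting implication.

    complete⇔extremallyOrderDisconnected : IsCompleteLattice ⇔ IsExtremallyOrderDisconnected
    complete⇔extremallyOrderDisconnected = mk⇔ ⇒ ⇐
      where
      ⇒ : IsCompleteLattice → IsExtremallyOrderDisconnected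
      ⇒ complete W open-W upset =
        proj₁ (≐𝔰⇒clopen-upset {S = cl₂ W} s
          ( (λ {x} x∈ → cl₂⊆𝔰s {x} (cl₂-mono {S = W} {V = ⋃𝔰 h} (λ {y} → W⊆⋃ {y}) {x} x∈))
          , (λ {x} s∈x → cl₂-mono {S = ⋃𝔰 h} {V = W} (λ {y} → ⋃⊆W {y}) {x} (𝔰s⊆cl₂ {x} s∈x))))
        where
        below : Pred Carrier ℓ
        -- The inclusion lives one level too high for a subset of the lattice; its Boolean truth
        -- value brings it down. These elements represent `W` as `⋃𝔰 h`.
        below c = Lift ℓ (T ⌊ 𝔰 c ⊆ W ⌋)
        h : ∃ below → Carrier
        h = proj₁
        s : Carrier
        s = proj₁ (proj₁ (complete below))
        W⊆⋃ : W ⊆ ⋃𝔰 h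
        W⊆⋃ {x} x∈W =
          let (a , a∈x , 𝔰a⊆W) =
                open-upset-𝔰 {S = W} {x} (λ {y} → open-W {y}) (λ {y} {z} → upset {y} {z}) x∈W in
          (a , lift (fromWitness (λ {y} → 𝔰a⊆W {y}))) , lift a∈x
        ⋃⊆W : ⋃𝔰 h ⊆ W
        ⋃⊆W {x} ((a , lift 𝔰a⊆W) , lift a∈x) = toWitness 𝔰a⊆W {x} a∈x
        s≐ : cl₂ (⋃𝔰 h) ≐ 𝔰 s
        s≐ = Equivalence.to (lub⇔cl₂ {f = h}) (proj₂ (proj₁ (complete below)))
        cl₂⊆𝔰s : cl₂ (⋃𝔰 h) ⊆ 𝔰 s
        cl₂⊆𝔰s {x} = proj₁ s≐ {x}
        𝔰s⊆cl₂ : 𝔰 s ⊆ cl₂ (⋃𝔰 h)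
        𝔰s⊆cl₂ {x} = proj₂ s≐ {x}

      ⇐ : IsExtremallyOrderDisconnected → IsCompleteLattice
      ⇐ eod S = join-of S , meet-of
        where
        join-of : ∀ S → ∃ (IsJoin S)
        join-of S = let (s , s≐) = clopen-upset⇒≐𝔰 {S = cl₂ (⋃𝔰 {I = ∃ S} proj₁)}
                          ( eod _ (λ {x} → ⋃𝔰-open {I = ∃ S} proj₁ {x})
                                  (λ {x} {y} → ⋃𝔰-upset {I = ∃ S} proj₁ {x} {y})
                          , λ {x} {y} → ↑-upset (cl (⋃𝔰 {I = ∃ S} proj₁)) {x} {y}) in
          s , Equivalence.from lub⇔cl₂ s≐
        meet-of : ∃ (IsMeet S)
        meet-of = let (s , ub , least) = join-of (lowerBounds S) in
          s , (λ (y , y∈S) → least y λ (z , z≤S) → z≤S y∈S) , λ z z≤S → ub (z , λ y∈S → z≤S (_ , y∈S))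

    -- An implication is a largest element of a relative annihilator, which by `annihilator-≙` means
    -- that `∁ (↓ (↥ (rect a b)))` is some `𝔰 c`; `∁↓-induction` then reaches all clopen sets.
    heyting⇔esakia : IsHeytingLattice ⇔ IsEsakiaSpace
    heyting⇔esakia = mk⇔ ⇒ ⇐
      where
      ⇒ : IsHeytingLattice → IsEsakiaSpace
      ⇒ (_⇨_ , heyting) C clopen =
        let (c , ⊆𝔰c , 𝔰c⊆) = ∁↓-induction {Q = λ W → ∃[ c ] W ≐ 𝔰 c}
              (λ (W⊆W′ , W′⊆W) (c , W⊆𝔰c , 𝔰c⊆W) → c , (λ {x} x∈W′ → W⊆𝔰c {x} (W′⊆W {x} x∈W′))
                                                    , (λ {x} c∈x → W⊆W′ {x} (𝔰c⊆W {x} c∈x)))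
              (λ (c , W⊆𝔰c , 𝔰c⊆W) (d , W⊆𝔰d , 𝔰d⊆W) → c ∧ d
                , (λ {x} (x∈W , x∈W′) → ∧-closed x (W⊆𝔰c {x} x∈W) (W⊆𝔰d {x} x∈W′))
                , (λ {x} c∧d∈x → let (c∈x , d∈x) = ∈-∧ {x} c∧d∈x in 𝔰c⊆W {x} c∈x , 𝔰d⊆W {x} d∈x))
              (λ a b → (a ⇨ b)
                , (λ {x} x∉ →
                     let (c , c∈x , 𝔰c⊆) = ∁↓-𝔰 {C = ↥ (rect a b)} {x} (λ {y} → rect-closed a b {y}) x∉ in
                     up x (transpose-⇨ (∧-swap (Equivalence.from (annihilator-≙ a b c) λ {y} → 𝔰c⊆ {y}))) c∈x)
                , (λ {x} → Equivalence.to (annihilator-≙ a b (a ⇨ b)) (∧-swap (transpose-∧ ≤-refl)) {x}))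
              C clopen
        in (λ {x} x∈↓C → int-rect {x = x} ⊤ c (⊤-closed x , λ c∈x → 𝔰c⊆ {x} c∈x x∈↓C)
                           λ {y} (_ , c∉y) → dne {P = y ∈ ↓ C} λ y∉↓C → c∉y (⊆𝔰c {y} y∉↓C))
         , (λ {x} x∉↓C → 𝔰⊆⇒int {x = x} c (⊆𝔰c {x} x∉↓C) λ {y} → 𝔰c⊆ {y})
        where open IsHeytingAlgebra heyting using (transpose-⇨; transpose-∧)

      ⇐ : IsEsakiaSpace → IsHeytingLattice
      ⇐ esakia = (λ a b → proj₁ (residual a b)) , record
        { isBoundedLattice = isBoundedLattice
        ; exponential      = λ w a b → let (c , ⊆𝔰c , 𝔰c⊆) = residual a b in
              (λ w∧a≤b → 𝔰-reflects-≤ λ {x} w∈x →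
                 ⊆𝔰c {x} (Equivalence.to (annihilator-≙ a b w) (∧-swap w∧a≤b) {x} w∈x))
            , (λ w≤c → ∧-swap (Equivalence.from (annihilator-≙ a b w) λ {x} w∈x → 𝔰c⊆ {x} (up x w≤c w∈x)))
        }
        where
        residual : ∀ a b → ∃[ c ] ∁ (↓ (↥ (rect a b))) ≐ 𝔰 c
        residual a b =
          let (open-↓ , closed-↓) = esakia (↥ (rect a b))
                ((λ {x} → rect-open a b {x}) , (λ {x} → rect-closed a b {x})) in
          clopen-upset⇒≐𝔰 {S = ∁ (↓ (↥ (rect a b)))}
            ( ((λ {x} → closed-↓ {x}) , (λ {x} → ∁-closed {S = ↓ (↥ (rect a b))} (λ {y} → open-↓ {y}) {x}))
            , (λ {x} {y} → ∁↓-upset (↥ (rect a b)) {x} {y}))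

    -- Joins of fewer than κ elements, and the members of `𝓑𝓛`.

    module _ {K : Set ℓ} where

      κ-clopen⇒⋃𝔰 : ∀ {W} → IsκClopenUpset K W → Σ (Set ℓ) λ I → I ≺ K × ∃[ f ] W ≐ ⋃𝔰 {I} f
      κ-clopen⇒⋃𝔰 (I , I≺K , V , clopen , W⊆ , W⊇) =
        I , I≺K , (λ i → proj₁ (h i))
        , (λ {x} x∈W → let (i , x∈Vi) = W⊆ {x} x∈W in i , lift (proj₁ (proj₂ (h i)) {x} x∈Vi))
        , (λ {x} (i , fi∈x) → W⊇ {x} (i , proj₂ (proj₂ (h i)) {x} (lower fi∈x)))
        where
        h : ∀ i → ∃[ a ] V i ≐ 𝔰 a
        h i = clopen-upset⇒≐𝔰 {S = V i} (clopen i)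

      ⋃𝔰-κ-clopen : I ≺ K → (f : I → Carrier) → IsκClopenUpset K (⋃𝔰 f)
      ⋃𝔰-κ-clopen I≺K f = _ , I≺K , (λ i → ↥ (𝔰 (f i))) , (λ i → 𝔰-clopen-upset (f i)) , (λ x∈ → x∈) , λ x∈ → x∈

      BL⇔ : ∀ {W} → BL K W ⇔ (Σ (Set ℓ) λ I → I ≺ K × ∃[ f ] W ≐ int₁ (cl (⋃𝔰 {I} f)))
      BL⇔ {W} = mk⇔
        (λ (V , κ , W⊆ , W⊇) → let (I , I≺K , f , V⊆ , V⊇) = κ-clopen⇒⋃𝔰 κ in I , I≺K , f
          , (λ {x} x∈W → int₁-mono {S = cl V} {V = cl (⋃𝔰 f)}
              (λ {y} → cl-mono {S = V} {V = ⋃𝔰 f} (λ {z} → V⊆ {z}) {y}) {x} (W⊆ {x} x∈W))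
          , (λ {x} x∈ → W⊇ {x} (int₁-mono {S = cl (⋃𝔰 f)} {V = cl V}
              (λ {y} → cl-mono {S = ⋃𝔰 f} {V = V} (λ {z} → V⊇ {z}) {y}) {x} x∈)))
        (λ (I , I≺K , f , W≐) → ⋃𝔰 f , ⋃𝔰-κ-clopen I≺K f , W≐)

      κ-frame⇔ : IsκFrame K ⇔ ((W : 𝓟X) → IsκClopenUpset K W → IsClopenUpset (cl W))
      κ-frame⇔ = mk⇔ ⇒ ⇐
        where
        ⇒ : IsκFrame K → (W : 𝓟X) → IsκClopenUpset K W → IsClopenUpset (cl W)
        ⇒ frame W κ =
          let (I , I≺K , f , W⊆ , W⊇) = κ-clopen⇒⋃𝔰 {W} κ
              (s , lub) = frame I I≺K f
              (cl⊆𝔰s , 𝔰s⊆cl) = Equivalence.to (distributive-lub⇔cl {f = f} {s}) lub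
          in ≐𝔰⇒clopen-upset {S = cl W} s
               ( (λ {x} x∈ → cl⊆𝔰s {x} (cl-mono {S = W} {V = ⋃𝔰 f} (λ {y} → W⊆ {y}) {x} x∈))
               , (λ {x} s∈x → cl-mono {S = ⋃𝔰 f} {V = W} (λ {y} → W⊇ {y}) {x} (𝔰s⊆cl {x} s∈x)))

        ⇐ : ((W : 𝓟X) → IsκClopenUpset K W → IsClopenUpset (cl W)) → IsκFrame K
        ⇐ clopen I I≺K f =
          let (s , s≐) = clopen-upset⇒≐𝔰 {S = cl (⋃𝔰 f)} (clopen (⋃𝔰 f) (⋃𝔰-κ-clopen I≺K f)) in
          s , Equivalence.from (distributive-lub⇔cl {f = f} {s}) s≐

      -- Meeting with `a` has the right adjoint `a ⇨_`, so it preserves all existing joins.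
      heyting∧κ-complete⇒κ-frame : IsHeytingLattice → IsκComplete K → IsκFrame K
      heyting∧κ-complete⇒κ-frame (_⇨_ , heyting) complete I I≺K f =
        let (s , f≤s , least) = complete I I≺K f in
        s , (f≤s , least) , λ a → (λ i → ∧-monotonic ≤-refl (f≤s i)) ,
          λ z a∧f≤z → ∧-swap (transpose-∧ (least (a ⇨ z) λ i → transpose-⇨ (∧-swap (a∧f≤z i))))
        where open IsHeytingAlgebra heyting using (transpose-⇨; transpose-∧)

      κ-frame⇒κ-complete : IsκFrame K → IsκComplete K
      κ-frame⇒κ-complete frame I I≺K f = let (s , lub , _) = frame I I≺K f in s , lub

      module _ (regularCardinal : IsRegularCardinal K) where
        open IsRegularCardinal regularCardinal

        ⊤-≺ : UnitP.⊤ {ℓ} ≺ K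
        ⊤-≺ = mk↣ {to = λ _ → Injection.to infinite 0} (λ _ → refl)
            , λ K↣⊤ → 0≢1 (Injection.injective infinite (Injection.injective K↣⊤ refl))
          where
          0≢1 : ¬ (0 ≡ 1)
          0≢1 ()

        ×-≺ : ∀ {I J : Set ℓ} → I ≺ K → J ≺ K → (I × J) ≺ K
        ×-≺ {J = J} I≺K J≺K = regular (λ _ → J) I≺K (λ _ → J≺K)

        -- Generators are combined along the construction: one for a principal ideal, pairwise meets
        -- for a meet, the disjoint union of families for a join. Regularity keeps the index types
        -- below κ.
        𝓑𝓛⇒hull : ∀ {D} → 𝓑𝓛 K D → Σ (Set ℓ) λ I → I ≺ K × ∃[ f ] member D ≐ hull {I} f
        𝓑𝓛⇒hull (generator a (D⊆ , D⊇)) = UnitP.⊤ , ⊤-≺ , (λ _ → a)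
          , (λ c∈D c b c∧a≤b → ≤-trans (∧-monotonic ≤-refl (D⊆ c∈D)) (c∧a≤b _))
          , (λ c∈hull → D⊇ (hull-least (λ _ → ≤-refl) c∈hull))
        𝓑𝓛⇒hull (meet D∈ E∈ (M⊆ , M⊇)) with 𝓑𝓛⇒hull D∈ | 𝓑𝓛⇒hull E∈
        ... | I , I≺K , f , D⊆ , D⊇ | J , J≺K , g , E⊆ , E⊇ = (I × J) , ×-≺ I≺K J≺K , (λ (i , j) → f i ∧ g j)
          , (λ c∈M → let (c∈D , c∈E) = M⊆ c∈M in proj₂ (hull-∩ f g) (D⊆ c∈D , E⊆ c∈E))
          , (λ c∈hull → let (c∈f , c∈g) = proj₁ (hull-∩ f g) c∈hull in M⊇ (D⊇ c∈f , E⊇ c∈g))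
        𝓑𝓛⇒hull (join {J} I I≺K D D∈ (D⊑J , least)) =
          Σ I (λ i → proj₁ (ih i)) , regular (λ i → proj₁ (ih i)) I≺K (λ i → proj₁ (proj₂ (ih i))) , F
          -- `J`, being least, is contained in `hullᴰ F`; conversely `J` is a D-ideal containing
          -- every `F (i , j)`.
          , least (hullᴰ F) (λ i c∈Di a b a∧F≤b →
              proj₁ (proj₂ (proj₂ (proj₂ (ih i)))) c∈Di a b λ j → a∧F≤b (i , j))
          , hullᴰ-⊑ J (λ (i , j) → D⊑J i (proj₂ (proj₂ (proj₂ (proj₂ (ih i)))) (∈-hull j)))
          where
          ih : ∀ i → Σ (Set ℓ) λ I → I ≺ K × ∃[ f ] member (D i) ≐ hull {I} f
          ih i = 𝓑𝓛⇒hull (D∈ i)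
          F : Σ I (λ i → proj₁ (ih i)) → Carrier
          F (i , j) = proj₁ (proj₂ (proj₂ (ih i))) j

        -- By `hullᴰ-⊑` such a D-ideal is the join of the principal ideals of its generators.
        hull⇒𝓑𝓛 : ∀ {D} → (Σ (Set ℓ) λ I → I ≺ K × ∃[ f ] member D ≐ hull {I} f) → 𝓑𝓛 K D
        hull⇒𝓑𝓛 {D} (I , I≺K , f , D⊆ , D⊇) =
          join I I≺K (λ i → principal (f i)) (λ i → generator (f i) ((λ x∈ → x∈) , λ x∈ → x∈))
            ( (λ i c≤fi → down D c≤fi (D⊇ (∈-hull i)))
            , (λ E principal⊑E c∈D → hullᴰ-⊑ E (λ i → principal⊑E i ≤-refl) (D⊆ c∈D)))

        𝓑𝓛⇔BL : ∀ {D W} → IsOpen W → IsUpset W → member D ≙ W → 𝓑𝓛 K D ⇔ BL K W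
        𝓑𝓛⇔BL {D} {W} open-W upset D≙W = mk⇔
          (λ D∈ → let (I , I≺K , f , D≐) = 𝓑𝓛⇒hull D∈ in
            Equivalence.from BL⇔ (I , I≺K , f , Equivalence.to (hull⇔ f) D≐))
          (λ W∈ → let (I , I≺K , f , W≐) = Equivalence.to BL⇔ W∈ in
            hull⇒𝓑𝓛 (I , I≺K , f , Equivalence.from (hull⇔ f) W≐))
          where
          hull⇔ : ∀ {I : Set ℓ} (f : I → Carrier) → member D ≐ hull f ⇔ W ≐ int₁ (cl (⋃𝔰 f))
          hull⇔ = ≙-hull⇔BL {N = member D} {W} (λ {x} → open-W {x}) (λ {x} {y} → upset {x} {y}) D≙W

        BL-resp : {W W′ : 𝓟X} → W ≐ W′ → BL K W → BL K W′
        BL-resp (W⊆W′ , W′⊆W) (V , κ , W⊆ , W⊇) =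
          V , κ , (λ {x} x∈W′ → W⊆ {x} (W′⊆W {x} x∈W′)) , (λ {x} x∈ → W⊆W′ {x} (W⊇ {x} x∈))

        BL-∩ : {W W′ : 𝓟X} → BL K W → BL K W′ → BL K (W ∩ W′)
        BL-∩ W∈ W′∈ =
          let (I , I≺K , f , W⊆ , W⊇) = Equivalence.to BL⇔ W∈
              (J , J≺K , g , W′⊆ , W′⊇) = Equivalence.to BL⇔ W′∈
              (∩⊆ , ∩⊇) = int₁cl-∩ f g
          in Equivalence.from BL⇔ ((I × J) , ×-≺ I≺K J≺K , (λ (i , j) → f i ∧ g j)
               , (λ {x} (x∈W , x∈W′) → ∩⊇ {x} (W⊆ {x} x∈W , W′⊆ {x} x∈W′))
               , (λ {x} x∈ → let (x∈f , x∈g) = ∩⊆ {x} x∈ in W⊇ {x} x∈f , W′⊇ {x} x∈g))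

        private
          B : Carrier → Carrier → 𝓟X
          B a b = ∁ (↓ (↥ (rect a b)))
          B-open : ∀ a b → IsOpen (B a b)
          B-open a b {x} = ∁↓-open {C = ↥ (rect a b)} (λ {y} → rect-closed a b {y}) {x}

          rect-clopen : ∀ a b → IsClopen (↥ (rect a b))
          rect-clopen a b = (λ {x} → rect-open a b {x}) , (λ {x} → rect-closed a b {x})

          annihilator-𝓑𝓛⇔BL : ∀ a b → 𝓑𝓛 K (annihilator a b) ⇔ BL K (B a b)
          annihilator-𝓑𝓛⇔BL a b = 𝓑𝓛⇔BL {annihilator a b} {B a b} (λ {x} → B-open a b {x})
            (λ {x} {y} → ∁↓-upset (↥ (rect a b)) {x} {y}) (annihilator-≙ a b)

          annihilator-normal⇔DM : ∀ a b → IsNormalIdeal (member (annihilator a b)) ⇔ DM (B a b)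
          annihilator-normal⇔DM a b = normal⇔DM {member (annihilator a b)} {B a b} (λ {x} → B-open a b {x})
            (λ {x} {y} → ∁↓-upset (↥ (rect a b)) {x} {y}) (annihilator-≙ a b)

        -- Annihilators match the rectangles, which are clopen; `∁↓-induction` extends the property
        -- from rectangles to all clopen sets. The next lemma follows the same scheme.
        annihilators-𝓑𝓛⇔ : (∀ a b → 𝓑𝓛 K (annihilator a b)) ⇔ ((C : 𝓟X) → IsClopen C → BL K (∁ (↓ C)))
        annihilators-𝓑𝓛⇔ = mk⇔
          (λ ann → ∁↓-induction {Q = BL K} BL-resp BL-∩ λ a b →
            Equivalence.to (annihilator-𝓑𝓛⇔BL a b) (ann a b))
          (λ bl a b → Equivalence.from (annihilator-𝓑𝓛⇔BL a b) (bl _ (rect-clopen a b)))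

        annihilators-normal⇔ : (∀ a b → IsNormalIdeal (member (annihilator a b))) ⇔
                               ((C : 𝓟X) → IsClopen C → DM (∁ (↓ C)))
        annihilators-normal⇔ = mk⇔
          (λ ann → ∁↓-induction {Q = DM} DM-resp DM-∩ λ a b →
            Equivalence.to (annihilator-normal⇔DM a b) (ann a b))
          (λ dm a b → Equivalence.from (annihilator-normal⇔DM a b) (dm _ (rect-clopen a b)))

theorem5p21 :
    (∀ {a} → ExcludedMiddle a) →
    (∀ {a b} → Extensionality a b) →
    ∀ {ℓ} (A : BoundedDistributiveLattice ℓ) (K : Set ℓ) →
    IsRegularCardinal K →
    let open LatticeNotions A
        open PriestleySpace A
    in
      ((IsCompleteLattice × IsκFrame K)
         ⇔ (IsExtremallyOrderDisconnected
            × ((U : 𝓟X) → IsκClopenUpset K U → IsClopenUpset (cl U))))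
    × ((IsκComplete K × IsHeytingLattice)
         ⇔ (IsEsakiaSpace
            × ((U : 𝓟X) → IsκClopenUpset K U → IsClopenUpset (cl U))))
    × ((∀ a b → 𝓑𝓛 K (annihilator a b))
         ⇔ ((U : 𝓟X) → IsClopen U → BL K (∁ (↓ U))))
    × ((∀ a b → IsNormalIdeal (member (annihilator a b)) × 𝓑𝓛 K (annihilator a b))
         ⇔ ((U : 𝓟X) → IsClopen U → DM (∁ (↓ U)) × BL K (∁ (↓ U))))
theorem5p21 em ext A K regularCardinal =
    (complete⇔extremallyOrderDisconnected ×-⇔ κ-frame⇔)
  , mk⇔
      -- For a Heyting lattice κ-completeness and being a κ-frame coincide, so the closure condition
      -- is again handled by `κ-frame⇔`.
      (λ (κ-complete , heyting) →
        to heyting⇔esakia heyting , to κ-frame⇔ (heyting∧κ-complete⇒κ-frame heyting κ-complete))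
      (λ (esakia , clopen) → κ-frame⇒κ-complete (from κ-frame⇔ clopen) , from heyting⇔esakia esakia)
  , annihilators-𝓑𝓛⇔ regularCardinal
  , mk⇔
      (λ ann → let dm = to (annihilators-normal⇔ regularCardinal) λ a b → proj₁ (ann a b)
                   bl = to (annihilators-𝓑𝓛⇔ regularCardinal) λ a b → proj₂ (ann a b)
               in λ C clopen → dm C clopen , bl C clopen)
      (λ dm∧bl → let normal = from (annihilators-normal⇔ regularCardinal) λ C clopen → proj₁ (dm∧bl C clopen)
                     bl     = from (annihilators-𝓑𝓛⇔ regularCardinal) λ C clopen → proj₂ (dm∧bl C clopen)
                 in λ a b → normal a b , bl a b)
  where
  open Classical em ext
  open Duality A
  open Equivalence using (to; from)
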